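{- There is an algorithm that, given a digraph $D$ on $n$ vertices and a positive integer $k$, decides whether $\ell(D)\geq k$ (the problem $k$-Leaf Out-Tree) in time $2^{O(k\log k)}\cdot n^{O(1)}$.
   Context: An out-tree of a digraph $D$ is a subgraph of $D$ that is a tree (ignoring arc directions) in which exactly one vertex, the root, has in-degree $0$ and every other vertex has in-degree $1$. A leaf of an out-tree is a vertex of out-degree $0$ in it. $\ell(D)$ denotes the maximum number of leaves over all out-trees of $D$. -}

module Defs where

open import Data.Bool.Base using (Bool; true; if_then_else_)
open import Data.Fin.Base using (Fin; fromℕ<; remQuot)
open import Data.Fin.Subset using (Subset; _∈_; _∩_; ∣_∣)
open import Data.List.Base using (List; []; _∷_; _++_; length)
open import Data.List.Relation.Unary.Linked using (Linked)
open import Data.List.Relation.Unary.Unique.Propositional using (Unique)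
open import Data.Nat.Base using (ℕ; suc; _+_; _*_; _∸_; _^_; _≤_; _≡ᵇ_)
open import Data.Nat.Properties using (_<?_)
open import Data.Product.Base using (Σ; ∃; ∃-syntax; _×_; _,_; uncurry)
open import Data.Sum.Base using (_⊎_)
open import Data.Vec.Base using (tabulate)
open import Level using (0ℓ)
open import Relation.Binary.Construct.Closure.Equivalence using (EqClosure)
open import Relation.Binary.Construct.Closure.Symmetric using (SymClosure)
open import Relation.Binary.Core using (Rel)
open import Relation.Binary.PropositionalEquality.Core using (_≡_; _≢_)
open import Relation.Nullary.Decidable.Core using (yes; no)
open import Relation.Nullary.Negation.Core using (¬_)

------------------------------------------------------------------------
-- Digraphs and out-trees

-- Adjacency matrices. Loops are allowed; no out-tree contains one.
Digraph : ℕ → Set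
Digraph n = Fin n → Fin n → Bool

Arc : ∀ {n} → Digraph n → Rel (Fin n) 0ℓ
Arc G u v = G u v ≡ true

outDegree : ∀ {n} → Digraph n → Fin n → ℕ
outDegree G u = ∣ tabulate (λ v → G u v) ∣

inDegree : ∀ {n} → Digraph n → Fin n → ℕ
inDegree G v = ∣ tabulate (λ u → G u v) ∣

record Subgraph {n} (D : Digraph n) : Set where
  field
    vertices : Subset n
    arcs     : Digraph n
    arcs⊆    : ∀ {u v} → Arc arcs u v → Arc D u v
    tail∈    : ∀ {u v} → Arc arcs u v → u ∈ vertices
    head∈    : ∀ {u v} → Arc arcs u v → v ∈ vertices

-- u ∷ xs lists the vertices of a cycle of length at least 3.
IsCycle : ∀ {n} → Rel (Fin n) 0ℓ → Fin n → List (Fin n) → Set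
IsCycle E u xs =
  2 ≤ length xs × Unique (u ∷ xs) × Linked E (u ∷ xs ++ u ∷ [])

-- The underlying undirected graph is a tree. The field asym rules out loops
-- and pairs of opposite arcs, that is, cycles of length 1 and 2 in the
-- underlying multigraph; acyclic rules out the longer ones.
record IsTree {n} {D : Digraph n} (H : Subgraph D) : Set where
  open Subgraph H
  field
    nonempty  : ∃[ v ] v ∈ vertices
    connected : ∀ {u v} → u ∈ vertices → v ∈ vertices →
                EqClosure (Arc arcs) u v
    asym      : ∀ {u v} → Arc arcs u v → ¬ Arc arcs v u
    acyclic   : ∀ u xs → ¬ IsCycle (SymClosure (Arc arcs)) u xs

record OutTree {n} (D : Digraph n) : Set where
  field
    subgraph : Subgraph D
    isTree   : IsTree subgraph
  open Subgraph subgraph public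
  field
    root          : Fin n
    root∈         : root ∈ vertices
    root-inDegree : inDegree arcs root ≡ 0
    inDegree≡1    : ∀ {v} → v ∈ vertices → v ≢ root → inDegree arcs v ≡ 1

leaves : ∀ {n} {D : Digraph n} → OutTree D → ℕ
leaves T = ∣ vertices ∩ tabulate (λ v → outDegree arcs v ≡ᵇ 0) ∣
  where open OutTree T

-- ℓ D ≐ m : the maximum number of leaves over all out-trees of D is m.
ℓ_≐_ : ∀ {n} → Digraph n → ℕ → Set
ℓ D ≐ m = (Σ (OutTree D) λ T → leaves T ≡ m) × (∀ (T : OutTree D) → leaves T ≤ m)

-- The digraph without vertices has no out-tree; it satisfies ℓ D ≥ k for no k.
ℓ_≥_ : ∀ {n} → Digraph n → ℕ → Set
ℓ D ≥ k = ∃[ m ] (ℓ D ≐ m × k ≤ m)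

------------------------------------------------------------------------
-- Model of computation: structured programs for a unit-cost random access
-- machine. A program mentions finitely many variables and arrays of natural
-- numbers; arrays are indexed indirectly. The only arithmetic operations are
-- addition and truncated subtraction, so after t steps every number has
-- O(t + input size) bits and the cost is polynomially related to the running
-- time of a Turing machine.

infixl 6 _⊕_ _⊖_

data Expr : Set where
  lit : ℕ → Expr
  var : ℕ → Expr
  arr : ℕ → Expr → Expr          -- arr a e is the entry of array a at index e
  _⊕_ : Expr → Expr → Expr
  _⊖_ : Expr → Expr → Expr

infix  5 _≔_ _⟦_⟧≔_
infixr 4 _⨟_

-- The conditions of if and while hold when their value is nonzero.
data Program : Set where
  skip               : Program
  _≔_                : ℕ → Expr → Program
  _⟦_⟧≔_             : ℕ → Expr → Expr → Program
  _⨟_                : Program → Program → Program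
  if′_then_else_     : Expr → Program → Program → Program
  while_loop_        : Expr → Program → Program

record State : Set where
  constructor state
  field
    vars : ℕ → ℕ
    arrs : ℕ → ℕ → ℕ

open State public

infixl 9 _[_↦_]

_[_↦_] : {A : Set} → (ℕ → A) → ℕ → A → (ℕ → A)
(f [ x ↦ a ]) y = if y ≡ᵇ x then a else f y

setVar : ℕ → ℕ → State → State
setVar x v s = state (vars s [ x ↦ v ]) (arrs s)

setArr : ℕ → ℕ → ℕ → State → State
setArr a i v s = state (vars s) (arrs s [ a ↦ arrs s a [ i ↦ v ] ])

eval : Expr → State → ℕ
eval (lit c)   s = c
eval (var x)   s = vars s x
eval (arr a e) s = arrs s a (eval e s)
eval (e ⊕ f)   s = eval e s + eval f s
eval (e ⊖ f)   s = eval e s ∸ eval f s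

cost : Expr → ℕ
cost (lit c)   = 1
cost (var x)   = 1
cost (arr a e) = suc (cost e)
cost (e ⊕ f)   = suc (cost e + cost f)
cost (e ⊖ f)   = suc (cost e + cost f)

-- p , s ⇓ s′ after t : started in s, program p halts in s′ after t steps.
infix 3 _,_⇓_after_

data _,_⇓_after_ : Program → State → State → ℕ → Set where

  skip⇓ : ∀ {s} → skip , s ⇓ s after 1

  ≔⇓ : ∀ {x e s} →
    x ≔ e , s ⇓ setVar x (eval e s) s after suc (cost e)

  ⟦⟧≔⇓ : ∀ {a e f s} →
    a ⟦ e ⟧≔ f , s ⇓ setArr a (eval e s) (eval f s) s after suc (cost e + cost f)

  ⨟⇓ : ∀ {p q s s′ s″ t t′} →
    p , s ⇓ s′ after t →
    q , s′ ⇓ s″ after t′ →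
    p ⨟ q , s ⇓ s″ after t + t′

  if-true⇓ : ∀ {e p q s s′ t} →
    eval e s ≢ 0 →
    p , s ⇓ s′ after t →
    if′ e then p else q , s ⇓ s′ after suc (cost e + t)

  if-false⇓ : ∀ {e p q s s′ t} →
    eval e s ≡ 0 →
    q , s ⇓ s′ after t →
    if′ e then p else q , s ⇓ s′ after suc (cost e + t)

  while-true⇓ : ∀ {e p s s′ s″ t t′} →
    eval e s ≢ 0 →
    p , s ⇓ s′ after t →
    while e loop p , s′ ⇓ s″ after t′ →
    while e loop p , s ⇓ s″ after suc (cost e + (t + t′))

  while-false⇓ : ∀ {e p s} →
    eval e s ≡ 0 →
    while e loop p , s ⇓ s after suc (cost e)

-- Row-major adjacency matrix: entry n * i + j is 1 if i → j is an arc, and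
-- all other entries are 0.
matrix : ∀ {n} → Digraph n → ℕ → ℕ
matrix {n} D p with p <? n * n
... | yes p<n² = if uncurry D (remQuot n (fromℕ< p<n²)) then 1 else 0
... | no  _    = 0

-- Variables 0 and 1 hold n and k, array 0 holds the digraph, and everything
-- else is 0.
input : ∀ {n} → Digraph n → ℕ → State
input {n} D k = state
  ((λ _ → 0) [ 0 ↦ n ] [ 1 ↦ k ])
  ((λ _ → λ _ → 0) [ 0 ↦ matrix D ])

output : State → ℕ
output s = vars s 0

-- The number b is the correct answer to the question whether A holds.
_Answers_ : ℕ → Set → Set
b Answers A = (b ≡ 1 × A) ⊎ (b ≡ 0 × ¬ A)

------------------------------------------------------------------------
-- Asymptotics

infix 4 _∈O_ _∈n^O[1]

_∈O_ : (ℕ → ℕ) → (ℕ → ℕ) → Set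
f ∈O g = ∃[ c ] ∃[ x₀ ] (∀ x → x₀ ≤ x → f x ≤ c * g x)

_∈n^O[1] : (ℕ → ℕ) → Set
h ∈n^O[1] = ∃[ d ] h ∈O (λ n → n ^ d)

{-# OPTIONS --safe #-}
module Submission where

-- Let r be a vertex, I a set of vertices, and let ∂ I consist of the vertices
-- outside I that are r or out-neighbours of I. An out-tree with root r and at
-- least k leaves exists iff |∂ I| ≥ k for some I all of whose vertices can be
-- reached from r inside I: take for I the vertices of the tree that are not
-- leaves; conversely the vertices of ∂ I are leaves of a tree grown along I.
-- Fix such a set J of minimal size. A search that has built I ⊆ J with
-- |∂ I| < k adds a vertex u ∈ ∂ I ∩ J, which it guesses by its rank, a number
-- below k. If u brought no new out-neighbour, or only one and that one outside
-- J, then J without u would be as good, against minimality. If it brings exactly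
-- one, that one lies in J and can be added next without a guess; otherwise |∂ I|
-- increases. So at most k ranks are guessed, and trying all k^k sequences of them
-- for every root decides the problem in time 2^(2k(1 + log k)) n^O(1).

open import Defs
open import Data.Bool.Base using (Bool; true; false; _∨_; if_then_else_) renaming (T to True)
import Data.Bool.Properties as Bool
import Data.Empty as Empty
open import Data.Fin.Base using (Fin; zero; suc; toℕ; fromℕ<; combine; remQuot)
open import Data.Fin.Properties using (_≟_; any?; toℕ<n; toℕ-injective; toℕ-fromℕ<; fromℕ<-toℕ; fromℕ<-cong; toℕ-combine; remQuot-combine)
open import Data.Fin.Subset using (Subset; inside; outside; _∈_; _∉_; _⊆_; _∩_; _∪_; _-_; ⁅_⁆; ⊥; ∣_∣; Nonempty)
open import Data.Fin.Subset.Properties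
open import Data.List.Base using (List; []; _∷_; _++_; length)
open import Data.List.Relation.Unary.All as All using (All; []; _∷_)
open import Data.List.Relation.Unary.AllPairs as AllPairs using ([]; _∷_)
open import Data.List.Relation.Unary.Linked using (Linked; []; _∷_)
open import Data.List.Relation.Unary.Unique.Propositional using (Unique)
open import Data.Nat.Base hiding (∣_-_∣)
open import Data.Nat.Divisibility using (divides)
open import Data.Nat.DivMod using (_/_; _%_; [m+kn]%n≡m%n; +-distrib-/-∣ʳ; m*n/n≡m; m/n≤m; m<n⇒m/n≡0; m<n⇒m%n≡m; m%n<n; m≡m%n+[m/n]*n)
open import Data.Nat.Logarithm using (⌊log₂_⌋; ⌊log₂⌋-mono-≤; ⌊log₂[2^n]⌋≡n)
import Data.Nat.Properties as ℕ
open import Data.Nat.Tactic.RingSolver using (solve-∀)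
open import Data.Product.Base using (Σ; ∃-syntax; _×_; _,_; proj₁; proj₂; uncurry)
open import Data.Sum.Base using (_⊎_; inj₁; inj₂)
open import Data.Unit.Base using (⊤; tt)
open import Data.Vec.Base using ([]; _∷_; tabulate; here; there)
open import Data.Vec.Properties using (lookup∘tabulate; []=⇒lookup; lookup⇒[]=)
open import Level using (0ℓ)
open import Relation.Binary.Construct.Closure.Equivalence as EqC using (EqClosure)
open import Relation.Binary.Construct.Closure.ReflexiveTransitive using (ε; _◅_)
open import Relation.Binary.Construct.Closure.Symmetric using (SymClosure; fwd; bwd)
open import Relation.Binary.Core using (Rel)
open import Relation.Binary.PropositionalEquality
open import Relation.Nullary using (Dec; yes; no; ¬_; contradiction)
open import Relation.Nullary.Decidable using (_×-dec_; _⊎-dec_; ¬?; does; dec-true)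
open import Relation.Unary using (Decidable)

-- Minimality of `J` enters as a descent: following a good set yields either a guess that works or a
-- strictly smaller good set, and sizes run out. Removing `u` is free because `u` itself joins the
-- boundary and makes up for the single out-neighbour that may drop out of it. The boundary never
-- shrinks along a successful search, so `k ∸ ∣ ∂ I ∣` bounds the number of digits still to be
-- guessed.
--
-- The program never checks whether a guess makes sense. Its flag is raised only when a grown set
-- with at least `k` boundary vertices has been seen, so a wrong guess can do no harm; completeness
-- is carried along as a promise conditional on the guess being right.
--
-- A sequence of ranks is stored as one number below `k ^ k`. The machine cannot divide, so digits
-- are split off by repeated subtraction, in time linear in the guess. Hence the second factor
-- `k ^ k`, and with it the 2 in the exponent.

does⇒ : {A : Set} (d : Dec A) → does d ≡ true → A
does⇒ (yes a) _ = a

-- Finite subsets and their cardinalities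

⟪_⟫ : ∀ {n} {P : Fin n → Set} → Decidable P → Subset n
⟪ P? ⟫ = tabulate (λ v → does (P? v))

module _ {n} {P : Fin n → Set} (P? : Decidable P) where

  ∈⟪⟫⁺ : ∀ {v} → P v → v ∈ ⟪ P? ⟫
  ∈⟪⟫⁺ {v} p = lookup⇒[]= v _ (trans (lookup∘tabulate _ v) (dec-true (P? v) p))

  ∈⟪⟫⁻ : ∀ {v} → v ∈ ⟪ P? ⟫ → P v
  ∈⟪⟫⁻ {v} v∈ = does⇒ (P? v) (trans (sym (lookup∘tabulate _ v)) ([]=⇒lookup v∈))

module _ {n} {f : Fin n → Bool} where

  ∈tabulate⁺ : ∀ {v} → f v ≡ true → v ∈ tabulate f
  ∈tabulate⁺ {v} eq = lookup⇒[]= v _ (trans (lookup∘tabulate f v) eq)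

  ∈tabulate⁻ : ∀ {v} → v ∈ tabulate f → f v ≡ true
  ∈tabulate⁻ {v} v∈ = trans (sym (lookup∘tabulate f v)) ([]=⇒lookup v∈)

x∉p-x : ∀ {n} (x : Fin n) (p : Subset n) → x ∉ p - x
x∉p-x zero    (_ ∷ _) ()
x∉p-x (suc x) (_ ∷ p) (there x∈) = x∉p-x x p x∈

x∈p⇒1≤∣p∣ : ∀ {n} {x : Fin n} {p} → x ∈ p → 1 ≤ ∣ p ∣
x∈p⇒1≤∣p∣ x∈p = ℕ.≤-<-trans z≤n (x∈p⇒∣p-x∣<∣p∣ x∈p)

1≤∣p∣⇒Nonempty : ∀ {n} {p : Subset n} → 1 ≤ ∣ p ∣ → Nonempty p
1≤∣p∣⇒Nonempty {n} {p} 1≤p with nonempty? p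
... | yes ne = ne
... | no ¬ne = contradiction (subst (λ q → 1 ≤ ∣ q ∣) (Empty-unique ¬ne) 1≤p)
    (λ le → ℕ.<⇒≱ le (ℕ.≤-reflexive (∣⊥∣≡0 n)))

∣p∣≡1⇒x≡y : ∀ {n} {p : Subset n} {x y} → ∣ p ∣ ≡ 1 → x ∈ p → y ∈ p → x ≡ y
∣p∣≡1⇒x≡y {p = p} {x} {y} eq x∈p y∈p with x ≟ y
... | yes x≡y = x≡y
... | no  x≢y = contradiction (subst (∣ p - x ∣ <_) eq (x∈p⇒∣p-x∣<∣p∣ x∈p))
    (ℕ.≤⇒≯ (x∈p⇒1≤∣p∣ (x∈p∧x≢y⇒x∈p-y y∈p (≢-sym x≢y))))

∣p∪⁅x⁆∣≡1+∣p∣ : ∀ {n} {p : Subset n} {x} → x ∉ p → ∣ p ∪ ⁅ x ⁆ ∣ ≡ suc ∣ p ∣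
∣p∪⁅x⁆∣≡1+∣p∣ {p = inside  ∷ p} {zero}  x∉p = contradiction here x∉p
∣p∪⁅x⁆∣≡1+∣p∣ {p = outside ∷ p} {zero}  x∉p = cong (λ q → suc ∣ q ∣) (∪-identityʳ p)
∣p∪⁅x⁆∣≡1+∣p∣ {p = inside  ∷ p} {suc x} x∉p = cong suc (∣p∪⁅x⁆∣≡1+∣p∣ (λ x∈p → x∉p (there x∈p)))
∣p∪⁅x⁆∣≡1+∣p∣ {p = outside ∷ p} {suc x} x∉p = ∣p∪⁅x⁆∣≡1+∣p∣ (λ x∈p → x∉p (there x∈p))

∣p∣≤1+∣p-x∣ : ∀ {n} (p : Subset n) x → ∣ p ∣ ≤ suc ∣ p - x ∣
∣p∣≤1+∣p-x∣ p x = ℕ.≤-trans (p⊆q⇒∣p∣≤∣q∣ p⊆) (ℕ.≤-reflexive (∣p∪⁅x⁆∣≡1+∣p∣ {p = p - x} (x∉p-x x p)))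
  where
  p⊆ : p ⊆ (p - x) ∪ ⁅ x ⁆
  p⊆ {y} y∈p with y ≟ x
  ... | yes refl = x∈p∪q⁺ (inj₂ (x∈⁅x⁆ x))
  ... | no  y≢x  = x∈p∪q⁺ (inj₁ (x∈p∧x≢y⇒x∈p-y y∈p y≢x))

-- `y` makes the inclusion of `p - x` in `q` strict, which pays for the loss of `x`. Every
-- comparison of two boundaries below is such a trade.
∣p∣≤∣q∣-exchange : ∀ {n} {p q : Subset n} {x y} → (∀ {z} → z ∈ p → z ≢ x → z ∈ q) → y ∈ q → y ∉ p → ∣ p ∣ ≤ ∣ q ∣
∣p∣≤∣q∣-exchange {p = p} {q} {x} {y} p-x⊆q y∈q y∉p =
    ℕ.≤-trans (∣p∣≤1+∣p-x∣ p x) (p⊂q⇒∣p∣<∣q∣ (⊆q , y , y∈q , λ y∈ → y∉p (p─q⊆p p ⁅ x ⁆ y∈)))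
  where
  ⊆q : p - x ⊆ q
  ⊆q z∈ = p-x⊆q (p─q⊆p p ⁅ x ⁆ z∈) (λ { refl → x∉p-x x p z∈ })

-- Ranks of elements in a subset

-- The number of elements of the subset below the given index. The index is a natural number so that
-- a loop counter can run up to `m`, where the cardinality is reached.
rank : ∀ {m} → Subset m → ℕ → ℕ
rank []            _       = 0
rank (_ ∷ p)       zero    = 0
rank (inside  ∷ p) (suc i) = suc (rank p i)
rank (outside ∷ p) (suc i) = rank p i

rank-0 : ∀ {m} (p : Subset m) → rank p 0 ≡ 0
rank-0 []      = refl
rank-0 (_ ∷ _) = refl

rank-∈ : ∀ {m} {p : Subset m} {v} → v ∈ p → rank p (suc (toℕ v)) ≡ suc (rank p (toℕ v))
rank-∈ {p = inside  ∷ p} {zero}  here = cong suc (rank-0 p)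
rank-∈ {p = inside  ∷ p} {suc v} (there v∈p) = cong suc (rank-∈ v∈p)
rank-∈ {p = outside ∷ p} {suc v} (there v∈p) = rank-∈ v∈p

rank-∉ : ∀ {m} {p : Subset m} {v} → v ∉ p → rank p (suc (toℕ v)) ≡ rank p (toℕ v)
rank-∉ {p = inside  ∷ p}     {zero}  v∉p = contradiction here v∉p
rank-∉ {p = outside ∷ []}    {zero}  v∉p = refl
rank-∉ {p = outside ∷ _ ∷ _} {zero}  v∉p = refl
rank-∉ {p = inside  ∷ p}     {suc v} v∉p = cong suc (rank-∉ (λ v∈p → v∉p (there v∈p)))
rank-∉ {p = outside ∷ p}     {suc v} v∉p = rank-∉ (λ v∈p → v∉p (there v∈p))

rank-all : ∀ {m} (p : Subset m) → rank p m ≡ ∣ p ∣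
rank-all []            = refl
rank-all (inside  ∷ p) = cong suc (rank-all p)
rank-all (outside ∷ p) = rank-all p

rank-mono : ∀ {m} (p : Subset m) {i j} → i ≤ j → rank p i ≤ rank p j
rank-mono []            _         = z≤n
rank-mono (_       ∷ p) z≤n       = z≤n
rank-mono (inside  ∷ p) (s≤s i≤j) = s≤s (rank-mono p i≤j)
rank-mono (outside ∷ p) (s≤s i≤j) = rank-mono p i≤j

rank<∣p∣ : ∀ {m} {p : Subset m} {v} → v ∈ p → rank p (toℕ v) < ∣ p ∣
rank<∣p∣ {m} {p} {v} v∈p = begin
  suc (rank p (toℕ v)) ≡⟨ sym (rank-∈ v∈p) ⟩
  rank p (suc (toℕ v)) ≤⟨ rank-mono p (toℕ<n v) ⟩
  rank p m             ≡⟨ rank-all p ⟩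
  ∣ p ∣                ∎
  where open ℕ.≤-Reasoning

Arc? : ∀ {n} (G : Digraph n) u v → Dec (Arc G u v)
Arc? G u v = G u v Bool.≟ true

-- Growing sets

module Growth {n} (D : Digraph n) (r : Fin n) where

  -- Counting `r` as reached makes the boundary of `⊥` consist of `r` alone, so the root is picked
  -- like any other vertex.
  Reached : Subset n → Fin n → Set
  Reached I v = v ≡ r ⊎ ∃[ u ] (u ∈ I × Arc D u v)

  reached? : ∀ I → Decidable (Reached I)
  reached? I v = (v ≟ r) ⊎-dec any? (λ u → (u ∈? I) ×-dec Arc? D u v)

  Boundary : Subset n → Fin n → Set
  Boundary I v = Reached I v × v ∉ I

  boundary? : ∀ I → Decidable (Boundary I)
  boundary? I v = reached? I v ×-dec ¬? (v ∈? I)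

  ∂ : Subset n → Subset n
  ∂ I = ⟪ boundary? I ⟫

  New : Subset n → Fin n → Fin n → Set
  New I u v = Arc D u v × ¬ Reached I v

  new? : ∀ I u → Decidable (New I u)
  new? I u v = Arc? D u v ×-dec ¬? (reached? I v)

  -- `extend` allows `u` to lie in `I` already: on a wrong guess the program may expand a vertex
  -- again.
  data Grown : Subset n → Set where
    empty  : Grown ⊥
    extend : ∀ {I u} → Grown I → Reached I u → Grown (I ∪ ⁅ u ⁆)

  data Conn (J : Subset n) : Fin n → Set where
    conn-root : r ∈ J → Conn J r
    conn-step : ∀ {u v} → Conn J u → v ∈ J → Arc D u v → Conn J v

  Spanning : Subset n → Set
  Spanning J = ∀ {v} → v ∈ J → Conn J v

  conn∈ : ∀ {J v} → Conn J v → v ∈ J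
  conn∈ (conn-root r∈J)     = r∈J
  conn∈ (conn-step _ v∈J _) = v∈J

  conn-mono : ∀ {I J v} → I ⊆ J → Conn I v → Conn J v
  conn-mono I⊆J (conn-root r∈I)     = conn-root (I⊆J r∈I)
  conn-mono I⊆J (conn-step c v∈I a) = conn-step (conn-mono I⊆J c) (I⊆J v∈I) a

  reached-mono : ∀ {I J v} → I ⊆ J → Reached I v → Reached J v
  reached-mono I⊆J (inj₁ v≡r)           = inj₁ v≡r
  reached-mono I⊆J (inj₂ (u , u∈I , a)) = inj₂ (u , I⊆J u∈I , a)

  grown⇒spanning : ∀ {I} → Grown I → Spanning I
  grown⇒spanning empty v∈⊥ = contradiction v∈⊥ ∉⊥
  grown⇒spanning (extend {I} {u} G Ru) v∈ with x∈p∪q⁻ I ⁅ u ⁆ v∈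
  ... | inj₁ v∈I = conn-mono (p⊆p∪q ⁅ u ⁆) (grown⇒spanning G v∈I)
  ... | inj₂ v∈⁅u⁆ with refl ← x∈⁅y⁆⇒x≡y u v∈⁅u⁆ with Ru
  ...   | inj₁ refl          = conn-root v∈
  ...   | inj₂ (w , w∈I , a) = conn-step (conn-mono (p⊆p∪q ⁅ u ⁆) (grown⇒spanning G w∈I)) v∈ a

  spanning⇒reached : ∀ {J v} → Spanning J → v ∈ J → Reached J v
  spanning⇒reached sp v∈J with sp v∈J
  ... | conn-root _     = inj₁ refl
  ... | conn-step c _ a = inj₂ (_ , conn∈ c , a)

  u∈I∪⁅u⁆ : ∀ {I : Subset n} {u} → u ∈ I ∪ ⁅ u ⁆
  u∈I∪⁅u⁆ {I} {u} = q⊆p∪q I _ (x∈⁅x⁆ u)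

  reached-∪⁻ : ∀ {I u v} → Reached (I ∪ ⁅ u ⁆) v → Reached I v ⊎ Arc D u v
  reached-∪⁻ (inj₁ v≡r) = inj₁ (inj₁ v≡r)
  reached-∪⁻ {I} {u} (inj₂ (w , w∈ , a)) with x∈p∪q⁻ I ⁅ u ⁆ w∈
  ... | inj₁ w∈I = inj₁ (inj₂ (w , w∈I , a))
  ... | inj₂ w∈⁅u⁆ with refl ← x∈⁅y⁆⇒x≡y u w∈⁅u⁆ = inj₂ a

  arc⇒reached-∪ : ∀ {I u v} → Arc D u v → Reached (I ∪ ⁅ u ⁆) v
  arc⇒reached-∪ {I} a = inj₂ (_ , u∈I∪⁅u⁆ {I} , a)

  old-boundary : ∀ {I u v} → Boundary I v → v ≢ u → Boundary (I ∪ ⁅ u ⁆) v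
  old-boundary {I} {u} (Rv , v∉I) v≢u = reached-mono (p⊆p∪q ⁅ u ⁆) Rv , λ v∈ → case-∪ (x∈p∪q⁻ I ⁅ u ⁆ v∈)
    where
    case-∪ : _ ⊎ _ → _
    case-∪ (inj₁ v∈I)   = v∉I v∈I
    case-∪ (inj₂ v∈⁅u⁆) = v≢u (x∈⁅y⁆⇒x≡y u v∈⁅u⁆)

  -- All members of a grown set are reached, and so is `u`; a vertex not yet reached is therefore
  -- none of them.
  new⇒boundary : ∀ {I u v} → Grown I → Reached I u → New I u v → Boundary (I ∪ ⁅ u ⁆) v
  new⇒boundary {I} {u} {v} G Ru (a , ¬Rv) = arc⇒reached-∪ {I} a , λ v∈ → case-∪ (x∈p∪q⁻ I ⁅ u ⁆ v∈)
    where
    case-∪ : v ∈ I ⊎ v ∈ ⁅ u ⁆ → Empty.⊥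
    case-∪ (inj₁ v∈I)   = ¬Rv (spanning⇒reached (grown⇒spanning G) v∈I)
    case-∪ (inj₂ v∈⁅u⁆) = ¬Rv (subst (Reached I) (sym (x∈⁅y⁆⇒x≡y u v∈⁅u⁆)) Ru)

  new∉∂ : ∀ {I u v} → New I u v → v ∉ ∂ I
  new∉∂ {I} (_ , ¬Rv) v∈∂ = ¬Rv (proj₁ (∈⟪⟫⁻ (boundary? I) v∈∂))

  expand-new : ∀ {I u w} → Grown I → Reached I u → New I u w → ∣ ∂ I ∣ ≤ ∣ ∂ (I ∪ ⁅ u ⁆) ∣
  expand-new {I} {u} {w} G Ru Nw = ∣p∣≤∣q∣-exchange {x = u} {y = w}
    (λ z∈ z≢u → ∈⟪⟫⁺ (boundary? _) (old-boundary (∈⟪⟫⁻ (boundary? I) z∈) z≢u))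
    (∈⟪⟫⁺ (boundary? _) (new⇒boundary G Ru Nw))
    (new∉∂ Nw)

  -- Only `u` can leave the boundary; `w` replaces it and `x` is the surplus.
  expand-branch : ∀ {I u w x} → Grown I → Reached I u → New I u w → New I u x → w ≢ x →
      suc ∣ ∂ I ∣ ≤ ∣ ∂ (I ∪ ⁅ u ⁆) ∣
  expand-branch {I} {u} {w} {x} G Ru Nw Nx w≢x = ℕ.≤-<-trans
    (∣p∣≤∣q∣-exchange {q = ∂ (I ∪ ⁅ u ⁆) - x} {x = u} {y = w}
      (λ z∈ z≢u → x∈p∧x≢y⇒x∈p-y (∈⟪⟫⁺ (boundary? _) (old-boundary (∈⟪⟫⁻ (boundary? I) z∈) z≢u))
          (λ { refl → new∉∂ Nx z∈ }))
      (x∈p∧x≢y⇒x∈p-y (∈⟪⟫⁺ (boundary? _) (new⇒boundary G Ru Nw)) w≢x)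
      (new∉∂ Nw))
    (x∈p⇒∣p-x∣<∣p∣ (∈⟪⟫⁺ (boundary? _) (new⇒boundary G Ru Nx)))

  -- Walking back along the path from `v` ends at a vertex whose predecessor lies in `I`, or at `r`.
  first-exit : ∀ {I J v} → Conn J v → v ∉ I → ∃[ u ] (u ∈ J × Boundary I u)
  first-exit (conn-root r∈J) r∉I = r , r∈J , inj₁ refl , r∉I
  first-exit {I} (conn-step {u} c v∈J a) v∉I with u ∈? I
  ... | yes u∈I = _ , v∈J , inj₂ (u , u∈I , a) , v∉I
  ... | no  u∉I = first-exit c u∉I

  boundary-exit : ∀ {I J} → Spanning J → I ⊆ J → ∣ ∂ I ∣ < ∣ ∂ J ∣ → ∃[ u ] (u ∈ J × Boundary I u)
  boundary-exit {I} {J} sp I⊆J lt with any? (λ v → (v ∈? J) ×-dec ¬? (v ∈? I))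
  ... | yes (v , v∈J , v∉I) = first-exit (sp v∈J) v∉I
  ... | no  ¬∃ = contradiction lt (subst (λ J′ → ¬ ∣ ∂ I ∣ < ∣ ∂ J′ ∣) (⊆-antisym I⊆J J⊆I) (ℕ.<-irrefl refl))
    where
    J⊆I : J ⊆ I
    J⊆I {v} v∈J with v ∈? I
    ... | yes v∈I = v∈I
    ... | no  v∉I = contradiction (v , v∈J , v∉I) ¬∃

  module _ {I J u} (spI : Spanning I) (sp : Spanning J) (I⊆J : I ⊆ J) (u∈J : u ∈ J) (bu : Boundary I u) where

    private
      I⊆J-u : I ⊆ J - u
      I⊆J-u v∈I = x∈p∧x≢y⇒x∈p-y (I⊆J v∈I) (λ { refl → proj₂ bu v∈I })

    -- A path that leaves `u` continues to a vertex of `J`. That vertex is not new, so it is reached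
    -- from `I`, and the path can be rerouted through `I`, which avoids `u`.
    remove-spanning : (∀ {v} → New I u v → v ∉ J) → Spanning (J - u)
    remove-spanning N∉J {v} v∈ = go (sp (p─q⊆p J ⁅ u ⁆ v∈)) v∈
      where
      via-I : ∀ {v} → v ∈ J - u → Reached I v → Conn (J - u) v
      via-I v∈ (inj₁ refl)          = conn-root v∈
      via-I v∈ (inj₂ (w , w∈I , a)) = conn-step (conn-mono I⊆J-u (spI w∈I)) v∈ a
      go : ∀ {v} → Conn J v → v ∈ J - u → Conn (J - u) v
      go (conn-root _) r∈ = conn-root r∈
      go {v} (conn-step {w} c v∈J a) v∈ with w ≟ u
      ... | no  w≢u  = conn-step (go c (x∈p∧x≢y⇒x∈p-y (conn∈ c) w≢u)) v∈ a
      ... | yes refl with reached? I v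
      ...   | yes Rv = via-I v∈ Rv
      ...   | no ¬Rv = contradiction v∈J (N∉J (a , ¬Rv))

    -- Only `w` can depend on `u` for being reached, and `u` takes its place in the boundary.
    remove-boundary : ∀ {w} → (∀ {v} → New I u v → v ≡ w) → ∣ ∂ J ∣ ≤ ∣ ∂ (J - u) ∣
    remove-boundary N≡w = ∣p∣≤∣q∣-exchange keep
      (∈⟪⟫⁺ (boundary? _) (reached-mono I⊆J-u (proj₁ bu) , x∉p-x u J))
      (λ u∈∂ → proj₂ (∈⟪⟫⁻ (boundary? J) u∈∂) u∈J)
      where
      still-reached : ∀ {z} → z ≢ _ → Reached J z → Reached (J - u) z
      still-reached z≢w (inj₁ z≡r) = inj₁ z≡r
      still-reached {z} z≢w (inj₂ (v , v∈J , a)) with v ≟ u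
      ... | no  v≢u  = inj₂ (v , x∈p∧x≢y⇒x∈p-y v∈J v≢u , a)
      ... | yes refl with reached? I z
      ...   | yes Rz = reached-mono I⊆J-u Rz
      ...   | no ¬Rz = contradiction (N≡w (a , ¬Rz)) z≢w
      keep : ∀ {z} → z ∈ ∂ J → z ≢ _ → z ∈ ∂ (J - u)
      keep z∈∂ z≢w with Rz , z∉J ← ∈⟪⟫⁻ (boundary? J) z∈∂ =
        ∈⟪⟫⁺ (boundary? _) (still-reached z≢w Rz , λ z∈ → z∉J (p─q⊆p J ⁅ u ⁆ z∈))


  -- Guesses as numbers, and existence of a good guess

  module Guided (k : ℕ) .{{_ : NonZero k}} where

    -- Leads I g: the search succeeds from I when the base-k digits of g, least
    -- significant first, are read as ranks in the boundary. Expands I u g: it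
    -- succeeds when about to expand u. An only new out-neighbour of u costs no
    -- digit.
    mutual
      data Leads (I : Subset n) (g : ℕ) : Set where
        done : k ≤ ∣ ∂ I ∣ → Leads I g
        pick : ∀ {u} → Boundary I u → rank (∂ I) (toℕ u) ≡ g % k → Expands I u (g / k) → Leads I g

      data Expands (I : Subset n) (u : Fin n) (g : ℕ) : Set where
        path   : ∀ {w} → New I u w → (∀ {v} → New I u v → v ≡ w) → Expands (I ∪ ⁅ u ⁆) w g → Expands I u g
        branch : ∀ {w x} → New I u w → New I u x → w ≢ x → Leads (I ∪ ⁅ u ⁆) g → Expands I u g

    Good : Subset n → Set
    Good J = Spanning J × k ≤ ∣ ∂ J ∣

    Smaller : Subset n → Set
    Smaller J = ∃[ J′ ] (∣ J′ ∣ < ∣ J ∣ × Good J′)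

    digit-% : ∀ {d} c → d < k → (d + c * k) % k ≡ d
    digit-% c d<k = trans ([m+kn]%n≡m%n _ c k) (m<n⇒m%n≡m d<k)

    digit-/ : ∀ {d} c → d < k → (d + c * k) / k ≡ c
    digit-/ {d} c d<k = trans (+-distrib-/-∣ʳ d (divides c refl))
      (cong₂ _+_ (m<n⇒m/n≡0 d<k) (m*n/n≡m c k))

    -- To be used with `m` the size of the boundary: a new least significant digit uses up one unit
    -- of the budget `k ∸ m`.
    digit-< : ∀ {d c m} → d < k → m < k → c < k ^ (k ∸ suc m) → d + c * k < k ^ (k ∸ m)
    digit-< {d} {c} {m} d<k m<k c< = begin-strict
      d + c * k           <⟨ ℕ.+-monoˡ-< (c * k) d<k ⟩
      suc c * k           ≤⟨ ℕ.*-monoˡ-≤ k c< ⟩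
      k ^ (k ∸ suc m) * k ≡⟨ ℕ.*-comm _ k ⟩
      k ^ suc (k ∸ suc m) ≡⟨ cong (k ^_) (sym (ℕ.+-∸-assoc 1 m<k)) ⟩
      k ^ (k ∸ m)         ∎
      where open ℕ.≤-Reasoning

    weaken-< : ∀ {c} a b → a ≤ b → c < k ^ (k ∸ b) → c < k ^ (k ∸ a)
    weaken-< a b a≤b c< = ℕ.<-≤-trans c< (ℕ.^-monoʳ-≤ k (ℕ.∸-monoʳ-≤ k a≤b))

    module _ {J : Subset n} (good : Good J) where

      private
        ⊆-extend : ∀ {I u} → I ⊆ J → u ∈ J → I ∪ ⁅ u ⁆ ⊆ J
        ⊆-extend {I} {u} I⊆J u∈J v∈ with x∈p∪q⁻ I ⁅ u ⁆ v∈
        ... | inj₁ v∈I = I⊆J v∈I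
        ... | inj₂ v∈⁅u⁆ with refl ← x∈⁅y⁆⇒x≡y u v∈⁅u⁆ = u∈J

        room : ∀ {I u} → I ⊆ J → u ∈ J → u ∉ I → ∣ I ∣ < ∣ J ∣
        room I⊆J u∈J u∉I = p⊂q⇒∣p∣<∣q∣ (I⊆J , _ , u∈J , u∉I)

        fuel-extend : ∀ f {I : Subset n} {u} → u ∉ I → ∣ J ∣ ≤ suc f + ∣ I ∣ → ∣ J ∣ ≤ f + ∣ I ∪ ⁅ u ⁆ ∣
        fuel-extend f {I} u∉I le = subst (∣ J ∣ ≤_)
            (sym (trans (cong (f +_) (∣p∪⁅x⁆∣≡1+∣p∣ {p = I} u∉I)) (ℕ.+-suc f ∣ I ∣))) le

      remove : ∀ {I u w} → Grown I → I ⊆ J → u ∈ J → Boundary I u →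
               (∀ {v} → New I u v → v ≡ w) → (∀ {v} → New I u v → v ∉ J) → Smaller J
      remove G I⊆J u∈J bu N≡w N∉J = _ , x∈p⇒∣p-x∣<∣p∣ u∈J ,
        remove-spanning sI (proj₁ good) I⊆J u∈J bu N∉J ,
        ℕ.≤-trans (proj₂ good) (remove-boundary sI (proj₁ good) I⊆J u∈J bu N≡w)
        where sI = grown⇒spanning G

      mutual
        -- The fuel `f` bounds the number of vertices of `J` still to be added. Below `k` boundary
        -- vertices `I` differs from `J`, so some boundary vertex lies in `J` and its rank is the
        -- digit.
        leads : ∀ f {I} → Grown I → I ⊆ J → ∣ J ∣ ≤ f + ∣ I ∣ →
                Smaller J ⊎ ∃[ c ] (c < k ^ (k ∸ ∣ ∂ I ∣) × Leads I c)
        leads f {I} G I⊆J fuel with k ℕ.≤? ∣ ∂ I ∣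
        ... | yes k≤ = inj₂ (0 , ℕ.m^n>0 k (k ∸ ∣ ∂ I ∣) , done k≤)
        ... | no  k≰ with u , u∈J , bu ← boundary-exit (proj₁ good) I⊆J
            (ℕ.<-≤-trans (ℕ.≰⇒> k≰) (proj₂ good)) = from-expands f fuel
          where
          r<k : rank (∂ I) (toℕ u) < k
          r<k = ℕ.<-trans (rank<∣p∣ (∈⟪⟫⁺ (boundary? I) bu)) (ℕ.≰⇒> k≰)
          from-expands : ∀ f → ∣ J ∣ ≤ f + ∣ I ∣ → Smaller J ⊎ ∃[ c ] (c < k ^ (k ∸ ∣ ∂ I ∣) × Leads I c)
          from-expands zero    fuel = contradiction (room I⊆J u∈J (proj₂ bu)) (ℕ.≤⇒≯ fuel)
          from-expands (suc f) fuel with expands f G I⊆J u∈J bu fuel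
          ... | inj₁ smaller = inj₁ smaller
          ... | inj₂ (c , c< , E) = inj₂ (_ , digit-< r<k (ℕ.≰⇒> k≰) c< ,
            pick bu (sym (digit-% c r<k)) (subst (Expands I u) (sym (digit-/ c r<k)) E))

        -- The `suc` in the exponent accounts for the digit spent on `u`. A branch earns it back by
        -- enlarging the boundary; a path passes the debt on to `w`, the boundary not having shrunk.
        expands : ∀ f {I u} → Grown I → I ⊆ J → u ∈ J → Boundary I u → ∣ J ∣ ≤ suc f + ∣ I ∣ →
                  Smaller J ⊎ ∃[ c ] (c < k ^ (k ∸ suc ∣ ∂ I ∣) × Expands I u c)
        expands f {I} {u} G I⊆J u∈J bu@(Ru , u∉I) fuel with any? (new? I u)
        -- Without new out-neighbours any vertex can serve as `w`.
        ... | no ¬N = inj₁ (remove {w = u} G I⊆J u∈J bu (λ N → contradiction (_ , N) ¬N)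
            (λ N → contradiction (_ , N) ¬N))
        ... | yes (w , Nw) with any? (λ x → new? I u x ×-dec ¬? (w ≟ x))
        ...   | yes (x , Nx , w≢x) with leads f (extend G Ru) (⊆-extend I⊆J u∈J) (fuel-extend f u∉I fuel)
        ...     | inj₁ smaller = inj₁ smaller
        ...     | inj₂ (c , c< , L) = inj₂
            (c , weaken-< _ ∣ ∂ (I ∪ ⁅ u ⁆) ∣ (expand-branch G Ru Nw Nx w≢x) c< , branch Nw Nx w≢x L)
        expands f {I} {u} G I⊆J u∈J bu@(Ru , u∉I) fuel | yes (w , Nw) | no ¬two = along (w ∈? J) f fuel
          where
          N≡w : ∀ {v} → New I u v → v ≡ w
          N≡w {v} Nv with w ≟ v
          ... | yes w≡v = sym w≡v
          ... | no  w≢v = contradiction (v , Nv , w≢v) ¬two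
          along : Dec (w ∈ J) → ∀ f → ∣ J ∣ ≤ suc f + ∣ I ∣ →
              Smaller J ⊎ ∃[ c ] (c < k ^ (k ∸ suc ∣ ∂ I ∣) × Expands I u c)
          along (no w∉J) _ _ = inj₁ (remove G I⊆J u∈J bu N≡w (λ N → subst (_∉ J) (sym (N≡w N)) w∉J))
          -- Two vertices of `J`, namely `u` and `w`, are missing from `I`, so the fuel cannot be
          -- used up yet.
          along (yes w∈J) zero fuel = contradiction
            (room (⊆-extend I⊆J u∈J) w∈J (proj₂ (new⇒boundary G Ru Nw)))
            (ℕ.≤⇒≯ (fuel-extend 0 u∉I fuel))
          along (yes w∈J) (suc f) fuel with expands f (extend G Ru) (⊆-extend I⊆J u∈J) w∈J
              (new⇒boundary G Ru Nw) (fuel-extend (suc f) u∉I fuel)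
          ... | inj₁ smaller = inj₁ smaller
          ... | inj₂ (c , c< , E) = inj₂
              (c , weaken-< _ (suc ∣ ∂ (I ∪ ⁅ u ⁆) ∣) (s≤s (expand-new G Ru Nw)) c< , path Nw N≡w E)

    -- The descent that stands in for the choice of a minimal good set.
    good⇒leads : ∀ m {J} → ∣ J ∣ < m → Good J → ∃[ c ] (c < k ^ k × Leads ⊥ c)
    good⇒leads (suc m) {J} (s≤s J≤m) good with leads good ∣ J ∣ empty (λ v∈ → contradiction v∈ ∉⊥) (ℕ.m≤m+n _ _)
    ... | inj₁ (J′ , J′<J , good′) = good⇒leads m (ℕ.<-≤-trans J′<J J≤m) good′
    ... | inj₂ (c , c< , L) = c , weaken-< 0 ∣ ∂ ⊥ ∣ z≤n c< , L

  -- From growing sets to out-trees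

  -- `depth` is any function that grows from parent to child. It is the fuel for climbing to the
  -- root and the ranking that excludes cycles.
  record Forest (I : Subset n) : Set where
    field
      parent : Fin n → Fin n
      depth  : Fin n → ℕ
      I⊆     : ∀ {v} → v ∈ I → Reached I v
      climb  : ∀ {v} → Reached I v → v ≢ r →
               parent v ∈ I × Arc D (parent v) v × depth (parent v) < depth v

  -- The parent of a vertex is settled when the vertex is reached for the first time: what `I`
  -- reaches keeps its parent and depth, everything else is hung below `u`. Values at `r` and at
  -- unreached vertices are arbitrary.
  plant : ∀ {I} → Grown I → Forest I
  plant empty = record
    { parent = λ v → v
    ; depth  = λ _ → 0
    ; I⊆     = λ v∈ → contradiction v∈ ∉⊥
    ; climb  = λ
      { (inj₁ v≡r) v≢r          → contradiction v≡r v≢r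
      ; (inj₂ (_ , u∈⊥ , _)) _  → contradiction u∈⊥ ∉⊥
      }
    }
  plant (extend {I} {u} G Ru) = record
    { parent = λ v → parent′ (reached? I v)
    ; depth  = λ v → depth′ v (reached? I v)
    ; I⊆     = λ v∈ → I⊆′ (x∈p∪q⁻ I ⁅ u ⁆ v∈)
    ; climb  = λ {v} R v≢r → climb′ (reached? I v) (reached-∪⁻ R) v≢r
    }
    where
    open Forest (plant G)
    parent′ : ∀ {v} → Dec (Reached I v) → Fin n
    parent′ {v} (yes _) = parent v
    parent′     (no _)  = u
    depth′ : ∀ v → Dec (Reached I v) → ℕ
    depth′ v (yes _) = depth v
    depth′ v (no _)  = suc (depth u)
    I⊆′ : ∀ {v} → v ∈ I ⊎ v ∈ ⁅ u ⁆ → Reached (I ∪ ⁅ u ⁆) v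
    I⊆′ (inj₁ v∈I) = reached-mono (p⊆p∪q ⁅ u ⁆) (I⊆ v∈I)
    I⊆′ (inj₂ v∈⁅u⁆) with refl ← x∈⁅y⁆⇒x≡y u v∈⁅u⁆ = reached-mono (p⊆p∪q ⁅ u ⁆) Ru
    depth-old : ∀ {v} → Reached I v → depth′ v (reached? I v) ≡ depth v
    depth-old {v} R with reached? I v
    ... | yes _ = refl
    ... | no ¬R = contradiction R ¬R
    climb′ : ∀ {v} (R? : Dec (Reached I v)) → Reached I v ⊎ Arc D u v → v ≢ r →
      parent′ R? ∈ I ∪ ⁅ u ⁆ × Arc D (parent′ R?) v × depth′ (parent′ R?) (reached? I (parent′ R?)) < depth′ v R?
    climb′ (yes R) _ v≢r with p∈I , a , lt ← climb R v≢r =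
      p⊆p∪q ⁅ u ⁆ p∈I , a , subst (_< _) (sym (depth-old (I⊆ p∈I))) lt
    climb′ (no ¬R) (inj₁ R) _ = contradiction R ¬R
    climb′ (no ¬R) (inj₂ a) _ = u∈I∪⁅u⁆ {I} , a , s≤s (ℕ.≤-reflexive (depth-old Ru))

-- Ranked relations with unique predecessors have no cycles

module _ {A : Set} {E : Rel A 0ℓ} (rk : A → ℕ) (rk-< : ∀ {u v} → E u v → rk u < rk v)
         (unique : ∀ {u v w} → E u w → E v w → u ≡ v) where

  private
    NonBacktracking : List A → Set
    NonBacktracking (x ∷ y ∷ z ∷ l) = x ≢ z × NonBacktracking (y ∷ z ∷ l)
    NonBacktracking _               = ⊤

    unique⇒nonBacktracking : ∀ a l {z} → Unique (a ∷ l) → All (_≢ z) (a ∷ l) → NonBacktracking (a ∷ l ++ z ∷ [])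
    unique⇒nonBacktracking a []          _ _ = tt
    unique⇒nonBacktracking a (b ∷ [])    _ (a≢z ∷ _) = a≢z , tt
    unique⇒nonBacktracking a (b ∷ c ∷ l) ((_ ∷ a≢c ∷ _) ∷ U) (_ ∷ ≢z) = a≢c , unique⇒nonBacktracking b (c ∷ l) U ≢z

    penultimate : A → List A → A
    penultimate a []      = a
    penultimate a (b ∷ l) = penultimate b l

    -- A walk that never backtracks and goes down once goes down ever after.
    descends : ∀ a b l z → E a b → Linked (SymClosure E) (b ∷ l ++ z ∷ []) →
        NonBacktracking (a ∷ b ∷ l ++ z ∷ []) →
               rk a < rk z × E (penultimate b l) z
    descends a b [] z ab (fwd bz ∷ _) _ = ℕ.<-trans (rk-< ab) (rk-< bz) , bz
    descends a b [] z ab (bwd zb ∷ _) (a≢z , _) = contradiction (unique ab zb) a≢z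
    descends a b (c ∷ l) z ab (fwd bc ∷ L) (_ , nb) with lt , e ← descends b c l z bc L nb =
        ℕ.<-trans (rk-< ab) lt , e
    descends a b (c ∷ l) z ab (bwd cb ∷ L) (a≢c , _) = contradiction (unique ab cb) a≢c

    tail-nb : ∀ a b l z → NonBacktracking (a ∷ b ∷ l ++ z ∷ []) → NonBacktracking (b ∷ l ++ z ∷ [])
    tail-nb a b []      z (_ , nb) = nb
    tail-nb a b (_ ∷ _) z (_ , nb) = nb

    -- Either the walk goes up all the way, or it turns down at some point and `descends` gives its
    -- last step.
    ascends : ∀ a l z → Linked (SymClosure E) (a ∷ l ++ z ∷ []) → NonBacktracking (a ∷ l ++ z ∷ []) →
              rk z < rk a ⊎ E (penultimate a l) z
    ascends a []      z (fwd az ∷ _) _ = inj₂ az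
    ascends a []      z (bwd za ∷ _) _ = inj₁ (rk-< za)
    ascends a (b ∷ l) z (fwd ab ∷ L) nb = inj₂ (proj₂ (descends a b l z ab L nb))
    ascends a (b ∷ l) z (bwd ba ∷ L) nb with ascends b l z L (tail-nb a b l z nb)
    ... | inj₁ lt = inj₁ (ℕ.<-trans lt (rk-< ba))
    ... | inj₂ e  = inj₂ e

    penultimate-All : ∀ {P : A → Set} a l → All P (a ∷ l) → P (penultimate a l)
    penultimate-All a []      (p ∷ _)  = p
    penultimate-All a (b ∷ l) (_ ∷ ps) = penultimate-All b l ps

  -- A cycle that starts downwards would give `u` a rank above its own. One that starts upwards to
  -- `x` cannot rise throughout, so it re-enters `u` from a predecessor, which must be `x`; but the
  -- last vertex of the cycle differs from `x`.
  ranked-acyclic : ∀ u xs → 2 ≤ length xs → Unique (u ∷ xs) → ¬ Linked (SymClosure E) (u ∷ xs ++ u ∷ [])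
  ranked-acyclic u (x ∷ y ∷ l) _ ((u≢x ∷ u≢y ∷ u≢l) ∷ U) (e ∷ L) = absurd e
    where
    nb : NonBacktracking (x ∷ y ∷ l ++ u ∷ [])
    nb = unique⇒nonBacktracking x (y ∷ l) U (All.map ≢-sym (u≢x ∷ u≢y ∷ u≢l))
    absurd : ¬ SymClosure E u x
    absurd (fwd ux) = ℕ.<-irrefl refl (proj₁ (descends u x (y ∷ l) u ux L (u≢y , nb)))
    absurd (bwd xu) with ascends x (y ∷ l) u L nb
    ... | inj₁ lt = ℕ.<-asym lt (rk-< xu)
    ... | inj₂ e  = penultimate-All y l (AllPairs.head U) (unique xu e)
  ranked-acyclic u (_ ∷ []) (s≤s ()) _ _

HasLeaves : ∀ {n} → Digraph n → ℕ → Set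
HasLeaves D k = Σ (OutTree D) λ T → k ≤ leaves T

module _ {n} {D : Digraph n} {r : Fin n} where
  open Growth D r

  module _ {I} (F : Forest I) where
    open Forest F

    private
      V : Subset n
      V = ⟪ reached? I ⟫

      IsArc : Fin n → Fin n → Set
      IsArc u v = Reached I v × v ≢ r × u ≡ parent v

      isArc? : ∀ u v → Dec (IsArc u v)
      isArc? u v = reached? I v ×-dec ¬? (v ≟ r) ×-dec (u ≟ parent v)

      -- Abstract so that the end points of an arc can be inferred from its type.
      abstract
        arcs : Digraph n
        arcs u v = does (isArc? u v)

        arc⁻ : ∀ {u v} → Arc arcs u v → IsArc u v
        arc⁻ {u} {v} = does⇒ (isArc? u v)

        arc⁺ : ∀ {u v} → IsArc u v → Arc arcs u v
        arc⁺ {u} {v} = dec-true (isArc? u v)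

      tail∈I : ∀ {u v} → Arc arcs u v → u ∈ I
      tail∈I {u} {v} a with R , v≢r , refl ← arc⁻ {u} {v} a = proj₁ (climb R v≢r)

      depth-< : ∀ {u v} → Arc arcs u v → depth u < depth v
      depth-< {u} {v} a with R , v≢r , refl ← arc⁻ {u} {v} a = proj₂ (proj₂ (climb R v≢r))

      subgraph : Subgraph D
      subgraph = record
        { vertices = V
        ; arcs     = arcs
        ; arcs⊆    = λ a → let R , v≢r , u≡ = arc⁻ a in subst (λ u → Arc D u _) (sym u≡) (proj₁ (proj₂ (climb R v≢r)))
        ; tail∈    = λ a → ∈⟪⟫⁺ (reached? I) (I⊆ (tail∈I a))
        ; head∈    = λ a → ∈⟪⟫⁺ (reached? I) (proj₁ (arc⁻ a))
        }

      to-root : ∀ m {v} → depth v < m → Reached I v → EqClosure (Arc arcs) v r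
      to-root (suc m) {v} (s≤s d≤m) R with v ≟ r
      ... | yes refl = ε
      ... | no  v≢r with p∈I , _ , lt ← climb R v≢r =
          bwd (arc⁺ (R , v≢r , refl)) ◅ to-root m (ℕ.<-≤-trans lt d≤m) (I⊆ p∈I)

      isTree : IsTree subgraph
      isTree = record
        { nonempty  = r , ∈⟪⟫⁺ (reached? I) (inj₁ refl)
        ; connected = λ u∈ v∈ → EqC.transitive _ (to-root _ ℕ.≤-refl (∈⟪⟫⁻ (reached? I) u∈))
            (EqC.symmetric _ (to-root _ ℕ.≤-refl (∈⟪⟫⁻ (reached? I) v∈)))
        ; asym      = λ a b → ℕ.<-asym (depth-< a) (depth-< b)
        ; acyclic   = λ u xs (len , U , L) → ranked-acyclic depth depth-<
                        (λ a b → trans (proj₂ (proj₂ (arc⁻ a))) (sym (proj₂ (proj₂ (arc⁻ b))))) u xs len U L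
        }

      ∣p∣≡0 : ∀ {p : Subset n} → (∀ {v} → v ∉ p) → ∣ p ∣ ≡ 0
      ∣p∣≡0 ∉p = trans (cong ∣_∣ (Empty-unique λ (_ , v∈) → ∉p v∈)) (∣⊥∣≡0 n)

    forest⇒outTree : OutTree D
    forest⇒outTree = record
      { subgraph      = subgraph
      ; isTree        = isTree
      ; root          = r
      ; root∈         = ∈⟪⟫⁺ (reached? I) (inj₁ refl)
      ; root-inDegree = ∣p∣≡0 (λ u∈ → proj₁ (proj₂ (arc⁻ (∈tabulate⁻ u∈))) refl)
      ; inDegree≡1    = λ {v} v∈ v≢r → trans (cong ∣_∣ (⊆-antisym
          (λ {u} u∈ → subst (_∈ ⁅ parent v ⁆) (sym (proj₂ (proj₂ (arc⁻ {u} (∈tabulate⁻ u∈))))) (x∈⁅x⁆ _))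
          (λ {u} u∈ → ∈tabulate⁺ (arc⁺ {u} (∈⟪⟫⁻ (reached? I) v∈ , v≢r , x∈⁅y⁆⇒x≡y _ u∈)))))
          (∣⁅x⁆∣≡1 (parent v))
      }

    -- All arcs of the tree start in `I`, so boundary vertices have out-degree 0.
    ∣∂∣≤leaves : ∣ ∂ I ∣ ≤ leaves forest⇒outTree
    ∣∂∣≤leaves = p⊆q⇒∣p∣≤∣q∣ λ {v} v∈∂ → let R , v∉I = ∈⟪⟫⁻ (boundary? I) v∈∂ in
      x∈p∩q⁺ (∈⟪⟫⁺ (reached? I) R , ∈tabulate⁺
          (cong (_≡ᵇ 0) (∣p∣≡0 (λ w∈ → v∉I (tail∈I (∈tabulate⁻ {f = arcs v} w∈))))))

  grown⇒hasLeaves : ∀ {I k} → Grown I → k ≤ ∣ ∂ I ∣ → HasLeaves D k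
  grown⇒hasLeaves G k≤ = forest⇒outTree (plant G) , ℕ.≤-trans k≤ (∣∂∣≤leaves (plant G))

-- From out-trees to spanning sets

module _ {n} {D : Digraph n} (T : OutTree D) where
  open OutTree T
  open Growth D root

  private
    data FromRoot : Fin n → Set where
      here : FromRoot root
      next : ∀ {u v} → FromRoot u → Arc arcs u v → FromRoot v

    parents-equal : ∀ {u w v} → v ≢ root → Arc arcs u v → Arc arcs w v → u ≡ w
    parents-equal v≢r a b = ∣p∣≡1⇒x≡y (inDegree≡1 (head∈ a) v≢r) (∈tabulate⁺ a) (∈tabulate⁺ b)

    no-arc-to-root : ∀ {u} → ¬ Arc arcs u root
    no-arc-to-root a = ℕ.<⇒≢ (x∈p⇒1≤∣p∣ (∈tabulate⁺ {f = λ u → arcs u root} a)) (sym root-inDegree)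

    -- Connectedness is undirected, but an arc traversed backwards must be the last arc of the
    -- directed path built so far, because in-degrees are at most 1; it just shortens that path.
    fromRoot-closed : ∀ {u v} → FromRoot u → EqClosure (Arc arcs) u v → FromRoot v
    fromRoot-closed p ε = p
    fromRoot-closed p (fwd a ◅ as) = fromRoot-closed (next p a) as
    fromRoot-closed here (bwd a ◅ as) = contradiction a no-arc-to-root
    fromRoot-closed {u} (next p a) (bwd b ◅ as) with u ≟ root
    ... | yes refl = contradiction a no-arc-to-root
    ... | no  u≢r with refl ← parents-equal u≢r a b = fromRoot-closed p as

    internal? : ∀ u → Dec (∃[ v ] Arc arcs u v)
    internal? u = any? (Arc? arcs u)

  internals : Subset n
  internals = ⟪ internal? ⟫

  internals-spanning : Spanning internals
  internals-spanning v∈ = conn (fromRoot-closed here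
      (IsTree.connected isTree root∈ (tail∈ (proj₂ (∈⟪⟫⁻ internal? v∈))))) v∈
    where
    conn : ∀ {v} → FromRoot v → v ∈ internals → Conn internals v
    conn here       v∈ = conn-root v∈
    conn (next p a) v∈ = conn-step (conn p (∈⟪⟫⁺ internal? (_ , a))) v∈ (arcs⊆ a)

  -- A leaf other than the root has a parent, which is internal.
  leaves≤∣∂∣ : leaves T ≤ ∣ ∂ internals ∣
  leaves≤∣∂∣ = p⊆q⇒∣p∣≤∣q∣ leaf⇒boundary
    where
    leaf⇒boundary : vertices ∩ tabulate (λ v → outDegree arcs v ≡ᵇ 0) ⊆ ∂ internals
    leaf⇒boundary {v} v∈ with v∈V , v∈leaf ← x∈p∩q⁻ vertices _ v∈ =
        ∈⟪⟫⁺ (boundary? internals) (reached , not-internal)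
      where
      not-internal : v ∉ internals
      not-internal v∈I with w , a ← ∈⟪⟫⁻ internal? v∈I =
        ℕ.<⇒≢ (x∈p⇒1≤∣p∣ (∈tabulate⁺ {f = arcs v} a)) (sym (ℕ.≡ᵇ⇒≡ _ 0 (subst True (sym (∈tabulate⁻ v∈leaf)) tt)))
      reached : Reached internals v
      reached with v ≟ root
      ... | yes v≡r = inj₁ v≡r
      ... | no  v≢r with u , u∈ ← 1≤∣p∣⇒Nonempty (ℕ.≤-reflexive (sym (inDegree≡1 v∈V v≢r))) =
        let a = ∈tabulate⁻ {f = λ u → arcs u v} u∈ in inj₂ (u , ∈⟪⟫⁺ internal? (_ , a) , arcs⊆ a)

-- Existence of the maximum number of leaves

leaves≤n : ∀ {n} {D : Digraph n} (T : OutTree D) → leaves T ≤ n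
leaves≤n T = ∣p∣≤n (OutTree.vertices T ∩ _)

-- A maximum exists because the bound on the number of leaves can be decided.
hasLeaves⇒ℓ≥ : ∀ {n} {D : Digraph n} {k} → (∀ m .{{_ : NonZero m}} → Dec (HasLeaves D m)) → HasLeaves D k → ℓ D ≥ k
hasLeaves⇒ℓ≥ {n} {D} hasLeaves? (T , k≤) =
  let m , k≤m , max = improve n T k≤ (ℕ.m≤m+n n _) in m , max , k≤m
  where
  improve : ∀ f (T : OutTree D) {k} → k ≤ leaves T → n ≤ f + leaves T → ∃[ m ] (k ≤ m × ℓ D ≐ m)
  improve f T k≤ fuel with hasLeaves? (suc (leaves T))
  ... | no ¬more = leaves T , k≤ , (T , refl) , λ T′ → ℕ.≮⇒≥ (λ lt → ¬more (T′ , lt))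
  improve zero    T k≤ fuel | yes (T′ , lt) = contradiction (ℕ.<-≤-trans lt (leaves≤n T′)) (ℕ.≤⇒≯ fuel)
  improve (suc f) T k≤ fuel | yes (T′ , lt) = improve f T′ (ℕ.≤-trans k≤ (ℕ.<⇒≤ lt))
    (ℕ.≤-trans fuel (ℕ.≤-trans (ℕ.≤-reflexive (sym (ℕ.+-suc f _))) (ℕ.+-monoʳ-≤ f lt)))

-- Running times of structured programs

-- A Boolean, so that for a concrete program `refl` proves that a variable survives.
writesVar : Program → ℕ → Bool
writesVar skip                    y = false
writesVar (x ≔ _)                 y = y ≡ᵇ x
writesVar (_ ⟦ _ ⟧≔ _)            y = false
writesVar (p ⨟ q)                 y = writesVar p y ∨ writesVar q y
writesVar (if′ _ then p else q)   y = writesVar p y ∨ writesVar q y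
writesVar (while _ loop p)        y = writesVar p y

writesArr : Program → ℕ → Bool
writesArr skip                    b = false
writesArr (_ ≔ _)                 b = false
writesArr (a ⟦ _ ⟧≔ _)            b = b ≡ᵇ a
writesArr (p ⨟ q)                 b = writesArr p b ∨ writesArr q b
writesArr (if′ _ then p else q)   b = writesArr p b ∨ writesArr q b
writesArr (while _ loop p)        b = writesArr p b

keepsVar : ∀ {p s s′ t x} → p , s ⇓ s′ after t → writesVar p x ≡ false → vars s′ x ≡ vars s x
keepsVar skip⇓ _ = refl
keepsVar ≔⇓ x≢ rewrite x≢ = refl
keepsVar ⟦⟧≔⇓ _ = refl
keepsVar (⨟⇓ {p} d e) w = trans (keepsVar e (Bool.∨-conicalʳ (writesVar p _) _ w))
    (keepsVar d (Bool.∨-conicalˡ _ _ w))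
keepsVar (if-true⇓ _ d) w = keepsVar d (Bool.∨-conicalˡ _ _ w)
keepsVar (if-false⇓ {p = p} _ d) w = keepsVar d (Bool.∨-conicalʳ (writesVar p _) _ w)
keepsVar (while-true⇓ _ d e) w = trans (keepsVar e w) (keepsVar d w)
keepsVar (while-false⇓ _) _ = refl

keepsArr : ∀ {p s s′ t a} → p , s ⇓ s′ after t → writesArr p a ≡ false → arrs s′ a ≡ arrs s a
keepsArr skip⇓ _ = refl
keepsArr ≔⇓ _ = refl
keepsArr ⟦⟧≔⇓ a≢ rewrite a≢ = refl
keepsArr (⨟⇓ {p} d e) w = trans (keepsArr e (Bool.∨-conicalʳ (writesArr p _) _ w))
    (keepsArr d (Bool.∨-conicalˡ _ _ w))
keepsArr (if-true⇓ _ d) w = keepsArr d (Bool.∨-conicalˡ _ _ w)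
keepsArr (if-false⇓ {p = p} _ d) w = keepsArr d (Bool.∨-conicalʳ (writesArr p _) _ w)
keepsArr (while-true⇓ _ d e) w = trans (keepsArr e w) (keepsArr d w)
keepsArr (while-false⇓ _) _ = refl

-- A relation between states instead of a derivation: between two rounds of a loop the frame of the
-- whole loop holds, although no complete run of the loop ends there.
record Frame (p : Program) (s s′ : State) : Set where
  field
    keeps  : ∀ {x} → writesVar p x ≡ false → vars s′ x ≡ vars s x
    keepsᵃ : ∀ {a} → writesArr p a ≡ false → arrs s′ a ≡ arrs s a

open Frame

record Runs (p : Program) (s : State) (Q : State → Set) (T : ℕ) : Set where
  constructor runs
  field
    {final} : State
    {time}  : ℕ
    halts   : p , s ⇓ final after time
    post    : Q final
    time≤   : time ≤ T

frame : ∀ {p s s′ t} → p , s ⇓ s′ after t → Frame p s s′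
frame d = record { keeps = keepsVar d ; keepsᵃ = keepsArr d }

weaken : ∀ {p s Q T T′} → Runs p s Q T → T ≤ T′ → Runs p s Q T′
weaken (runs d q t≤) T≤ = runs d q (ℕ.≤-trans t≤ T≤)

run-post : ∀ {p s T} {Q Q′ : State → Set} → (∀ {s′} → Q s′ → Q′ s′) → Runs p s Q T → Runs p s Q′ T
run-post Q⇒Q′ (runs d q t≤) = runs d (Q⇒Q′ q) t≤

run-framed : ∀ {p s Q T} → Runs p s Q T → Runs p s (λ s′ → Frame p s s′ × Q s′) T
run-framed (runs d q t≤) = runs d (frame d , q) t≤

run-skip : ∀ {s} {Q : State → Set} → Q s → Runs skip s Q 1
run-skip q = runs skip⇓ q ℕ.≤-refl

run-≔ : ∀ {x e s} {Q : State → Set} → Q (setVar x (eval e s) s) → Runs (x ≔ e) s Q (suc (cost e))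
run-≔ q = runs ≔⇓ q ℕ.≤-refl

run-⟦⟧≔ : ∀ {a e f s} {Q : State → Set} → Q (setArr a (eval e s) (eval f s) s) →
    Runs (a ⟦ e ⟧≔ f) s Q (suc (cost e + cost f))
run-⟦⟧≔ q = runs ⟦⟧≔⇓ q ℕ.≤-refl

run-⨟ : ∀ {p q s Q′ Q T T′} → Runs p s Q′ T → (∀ {s′} → Frame p s s′ → Q′ s′ → Runs q s′ Q T′) →
    Runs (p ⨟ q) s Q (T + T′)
run-⨟ (runs d q′ t≤) k with runs e q t′≤ ← k (frame d) q′ = runs (⨟⇓ d e) q (ℕ.+-mono-≤ t≤ t′≤)

run-≔⨟ : ∀ {x e q s Q T} → Runs q (setVar x (eval e s) s) Q T → Runs (x ≔ e ⨟ q) s Q (suc (cost e) + T)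
run-≔⨟ {e = e} (runs d q t≤) = runs (⨟⇓ ≔⇓ d) q (ℕ.+-monoʳ-≤ (suc (cost e)) t≤)

run-⟦⟧≔⨟ : ∀ {a e f q s Q T} → Runs q (setArr a (eval e s) (eval f s) s) Q T →
    Runs (a ⟦ e ⟧≔ f ⨟ q) s Q (suc (cost e + cost f) + T)
run-⟦⟧≔⨟ {e = e} {f} (runs d q t≤) = runs (⨟⇓ ⟦⟧≔⇓ d) q (ℕ.+-monoʳ-≤ (suc (cost e + cost f)) t≤)

-- The sum of both branches replaces their maximum, so that time bounds remain polynomials for the
-- ring solver.
run-if : ∀ {e p q s Q T T′} → (eval e s ≢ 0 → Runs p s Q T) → (eval e s ≡ 0 → Runs q s Q T′) →
         Runs (if′ e then p else q) s Q (suc (cost e + (T + T′)))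
run-if {e} {s = s} then′ else′ with eval e s ℕ.≟ 0
... | yes ≡0 with runs d q t≤ ← else′ ≡0 = runs (if-false⇓ ≡0 d) q (s≤s (ℕ.+-monoʳ-≤ (cost e) (ℕ.m≤n⇒m≤o+n _ t≤)))
... | no  ≢0 with runs d q t≤ ← then′ ≢0 = runs (if-true⇓ ≢0 d) q (s≤s (ℕ.+-monoʳ-≤ (cost e) (ℕ.m≤n⇒m≤n+o _ t≤)))

run-while-false : ∀ {e p s} {Q : State → Set} → eval e s ≡ 0 → Q s → Runs (while e loop p) s Q (suc (cost e))
run-while-false ≡0 q = runs (while-false⇓ ≡0) q ℕ.≤-refl

run-while-true : ∀ {e p s Q′ Q T T′} → eval e s ≢ 0 → Runs p s Q′ T →
                 (∀ {s′} → Frame p s s′ → Q′ s′ → Runs (while e loop p) s′ Q T′) →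
                 Runs (while e loop p) s Q (suc (cost e + (T + T′)))
run-while-true {e} ≢0 (runs d q′ t≤) k with runs d′ q t′≤ ← k (frame d) q′ =
  runs (while-true⇓ ≢0 d d′) q (s≤s (ℕ.+-monoʳ-≤ (cost e) (ℕ.+-mono-≤ t≤ t′≤)))

for_below_run_ : ℕ → ℕ → Program → Program
for x below y run p = x ≔ lit 0 ⨟ while (var y ⊖ var x) loop (p ⨟ x ≔ var x ⊕ lit 1)

infixr 5 for_below_run_

≤-by : ∀ {a b} d → b ≡ a + d → a ≤ b
≤-by {a} d eq = ℕ.≤-trans (ℕ.m≤m+n a d) (ℕ.≤-reflexive (sym eq))

[↦]-same : {A : Set} (f : ℕ → A) (x : ℕ) {a : A} → (f [ x ↦ a ]) x ≡ a
[↦]-same f x with x ≡ᵇ x in eq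
... | true  = refl
... | false = contradiction (subst True eq (ℕ.≡⇒≡ᵇ x x refl)) (λ ())

[↦]-other : {A : Set} (f : ℕ → A) {x y : ℕ} {a : A} → y ≢ x → (f [ x ↦ a ]) y ≡ f y
[↦]-other f {x} {y} y≢x with y ≡ᵇ x in eq
... | true  = contradiction (ℕ.≡ᵇ⇒≡ y x (subst True (sym eq) _)) y≢x
... | false = refl

-- `step` must establish the invariant for every value `v` of the counter; this takes care of the
-- increment once and for all.
module _ {x y p s m T} (Inv : ℕ → State → Set)
         (y≢x : (y ≡ᵇ x) ≡ false) (x∉p : writesVar p x ≡ false) (y∉p : writesVar p y ≡ false)
         (y≡m : vars s y ≡ m) (init : Inv 0 (setVar x 0 s))
         (step : ∀ {i s₁} → i < m → Frame (for x below y run p) s s₁ → vars s₁ x ≡ i → Inv i s₁ →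
                 Runs p s₁ (λ s₂ → ∀ v → Inv (suc i) (setVar x v s₂)) T) where

  private
    body : Program
    body = p ⨟ x ≔ var x ⊕ lit 1

    for-frame : ∀ {s₁ s₂ s₃} → Frame (for x below y run p) s₁ s₂ → Frame body s₂ s₃ →
        Frame (for x below y run p) s₁ s₃
    for-frame F G .keeps  {z} w = trans (keeps G {z} (Bool.∨-conicalʳ (z ≡ᵇ x) _ w)) (keeps F {z} w)
    for-frame F G .keepsᵃ w = trans (keepsᵃ G w) (keepsᵃ F w)

    y∉for : writesVar (for x below y run p) y ≡ false
    y∉for rewrite y≢x | y∉p = refl

    iterations : ∀ j {i s₁} → i + j ≡ m → Frame (for x below y run p) s s₁ → vars s₁ x ≡ i → Inv i s₁ →
                 Runs (while (var y ⊖ var x) loop body) s₁ (Inv m) (j * (T + 8) + 4)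
    iterations zero {i} {s₁} i+0≡m F x≡i inv = run-while-false
      (trans (cong₂ _∸_ (trans (keeps F y∉for) y≡m) x≡i) (trans (cong (_∸ i) i≡m) (ℕ.n∸n≡0 i)))
      (subst (λ i → Inv i s₁) (sym i≡m) inv)
      where
      i≡m : m ≡ i
      i≡m = trans (sym i+0≡m) (ℕ.+-identityʳ i)
    iterations (suc j) {i} {s₁} i+j≡m F x≡i inv = weaken
      (run-while-true (λ ≡0 → ℕ.<⇒≱ i<m (ℕ.m∸n≡0⇒m≤n (trans (sym (cong₂ _∸_ (trans (keeps F y∉for) y≡m) x≡i)) ≡0)))
        (run-⨟ (step i<m F x≡i inv) (λ {s₂} G inv′ → run-≔ {Q = λ s₃ → vars s₃ x ≡ suc i × Inv (suc i) s₃}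
          (trans ([↦]-same (vars s₂) x) (trans (ℕ.+-comm _ 1) (cong suc (trans (keeps G x∉p) x≡i))) , inv′ _)))
        (λ G (x≡ , inv′) → iterations j (trans (sym (ℕ.+-suc i j)) i+j≡m) (for-frame F G) x≡ inv′))
      (ℕ.≤-reflexive (arith T (j * (T + 8))))
      where
      i<m : i < m
      i<m = subst (i <_) i+j≡m (ℕ.m<m+n i (s≤s z≤n))
      arith : ∀ T X → suc (3 + (T + 4 + (X + 4))) ≡ T + 8 + X + 4
      arith = solve-∀

  -- The 8 is a test and an increment, 4 steps each; the 6 is the initial assignment and the failing
  -- test.
  run-for : Runs (for x below y run p) s (Inv m) (m * (T + 8) + 6)
  run-for = weaken (run-≔⨟ (iterations m refl
    (record { keeps = λ {z} w → [↦]-other (vars s) (λ { refl → x-written w }) ; keepsᵃ = λ _ → refl })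
    ([↦]-same (vars s) x) init)) (ℕ.≤-reflexive (arith (m * (T + 8))))
    where
    x-written : ¬ writesVar (for x below y run p) x ≡ false
    x-written w with x ≡ᵇ x | ℕ.≡⇒≡ᵇ x x refl
    x-written () | true | _
    arith : ∀ X → 2 + (X + 4) ≡ X + 6
    arith = solve-∀

-- The search program

nᵛ kᵛ rootᵛ guessᵛ limitᵛ uᵛ newᵛ gᵛ qᵛ mᵛ roundᵛ vᵛ baseᵛ foundᵛ roundsᵛ powᵛ : ℕ
nᵛ      = 0
kᵛ      = 1
rootᵛ   = 2
guessᵛ  = 3
limitᵛ  = 4
uᵛ      = 5
newᵛ    = 6
gᵛ      = 7
qᵛ      = 8
mᵛ      = 9
roundᵛ  = 10
vᵛ      = 11
baseᵛ   = 12
foundᵛ  = 13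
roundsᵛ = 14
powᵛ    = 15

adjᵃ reachedᵃ internalᵃ : ℕ
adjᵃ      = 0
reachedᵃ  = 1
internalᵃ = 2

power : Program
power = limitᵛ ≔ lit 1 ⨟ for roundᵛ below kᵛ run
  (powᵛ ≔ lit 0 ⨟ for vᵛ below kᵛ run (powᵛ ≔ var powᵛ ⊕ var limitᵛ) ⨟ limitᵛ ≔ var powᵛ)

reset : Program
reset =
  for vᵛ below nᵛ run (reachedᵃ ⟦ var vᵛ ⟧≔ lit 0 ⨟ internalᵃ ⟦ var vᵛ ⟧≔ lit 0) ⨟
  reachedᵃ ⟦ var rootᵛ ⟧≔ lit 1 ⨟
  uᵛ ≔ var rootᵛ ⨟
  newᵛ ≔ lit 0 ⨟
  gᵛ ≔ var guessᵛ

-- `var gᵛ ⊕ lit 1 ⊖ var kᵛ` is nonzero exactly if `kᵛ` is at most `gᵛ`. The remainder, left in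
-- `gᵛ`, is the next digit.
divide : Program
divide = qᵛ ≔ lit 0 ⨟ while var gᵛ ⊕ lit 1 ⊖ var kᵛ loop (gᵛ ≔ var gᵛ ⊖ var kᵛ ⨟ qᵛ ≔ var qᵛ ⊕ lit 1)

-- The assignment to uᵛ is made while the rank is at most gᵛ, so the last one made
-- is to the boundary vertex of rank gᵛ, if there is one.
scan : Program
scan = mᵛ ≔ lit 0 ⨟ for vᵛ below nᵛ run
  (if′ arr reachedᵃ (var vᵛ) ⊖ arr internalᵃ (var vᵛ)
   then ((if′ var gᵛ ⊕ lit 1 ⊖ var mᵛ then uᵛ ≔ var vᵛ else skip) ⨟ mᵛ ≔ var mᵛ ⊕ lit 1)
   else skip)

select : Program
select = divide ⨟ scan ⨟ (if′ var mᵛ ⊕ lit 1 ⊖ var kᵛ then foundᵛ ≔ lit 1 else skip) ⨟ gᵛ ≔ var qᵛ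

-- Overwriting `uᵛ` leaves it at the last new out-neighbour, so an only one is already in place for
-- the next round.
expand : Program
expand =
  baseᵛ ≔ lit 0 ⨟
  for vᵛ below uᵛ run (baseᵛ ≔ var baseᵛ ⊕ var nᵛ) ⨟
  internalᵃ ⟦ var uᵛ ⟧≔ lit 1 ⨟
  newᵛ ≔ lit 0 ⨟
  for vᵛ below nᵛ run
    (if′ arr adjᵃ (var baseᵛ ⊕ var vᵛ) ⊖ arr reachedᵃ (var vᵛ)
     then (reachedᵃ ⟦ var vᵛ ⟧≔ lit 1 ⨟ newᵛ ≔ var newᵛ ⊕ lit 1 ⨟ uᵛ ≔ var vᵛ)
     else skip)

-- The condition says newᵛ ≠ 1.
round : Program
round = (if′ (var newᵛ ⊖ lit 1) ⊕ (lit 1 ⊖ var newᵛ) then select else skip) ⨟ expand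

-- A successful search adds a vertex in each round until it is found successful,
-- so n + 1 rounds suffice.
trial : Program
trial = reset ⨟ for roundᵛ below roundsᵛ run round

leafOutTree : Program
leafOutTree =
  roundsᵛ ≔ var nᵛ ⊕ lit 1 ⨟
  power ⨟
  for rootᵛ below nᵛ run (for guessᵛ below limitᵛ run trial) ⨟
  nᵛ ≔ var foundᵛ

-- Vertex sets in arrays, and arithmetic subroutines

Encodes : ∀ {n} → (Fin n → Set) → (ℕ → ℕ) → Set
Encodes P a = ∀ v → (P v → a (toℕ v) ≡ 1) × (¬ P v → a (toℕ v) ≡ 0)

bit≢0 : ∀ {P : Set} {a} → Dec P → (¬ P → a ≡ 0) → a ≢ 0 → P
bit≢0 (yes p) _ _  = p
bit≢0 (no ¬p) f a≢ = contradiction (f ¬p) a≢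

bit≡0 : ∀ {P : Set} {a} → (P → a ≡ 1) → a ≡ 0 → ¬ P
bit≡0 f refl p with () ← f p

matrix-encodes : ∀ {n} (D : Digraph n) u → Encodes (Arc D u) (λ v → matrix D (n * toℕ u + v))
matrix-encodes {n} D u v = (λ a → trans entry (cong (if_then 1 else 0) a)) , λ ¬a →
    trans entry (cong (if_then 1 else 0) (Bool.¬-not ¬a))
  where
  entry : matrix D (n * toℕ u + toℕ v) ≡ (if D u v then 1 else 0)
  entry with n * toℕ u + toℕ v ℕ.<? n * n
  ... | yes p< = cong (if_then 1 else 0) (cong (uncurry D) (trans
    (cong (remQuot n) (trans (fromℕ<-cong _ _ (sym (toℕ-combine u v)) p< (toℕ<n (combine u v)))
        (fromℕ<-toℕ (combine u v) _)))
    (remQuot-combine u v)))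
  ... | no  p≮ = contradiction (subst (_< n * n) (toℕ-combine u v) (toℕ<n (combine u v))) p≮

run-power : ∀ {s κ} → vars s kᵛ ≡ κ →
    Runs power s (λ s′ → vars s′ limitᵛ ≡ κ ^ κ) (2 + (κ * (2 + (κ * 12 + 6 + 2) + 8) + 6))
run-power {s} {κ} k≡ = run-≔⨟ (run-for (λ i s → vars s limitᵛ ≡ κ ^ i) refl refl refl k≡ refl
  (λ {i} {s₁} _ F _ limit≡ → run-≔⨟ (run-⨟
    (run-for (λ j s → vars s powᵛ ≡ j * κ ^ i) refl refl refl (trans (keeps F {kᵛ} refl) k≡) refl
      (λ {j} {s₂} _ G _ pow≡ → run-≔
          (λ _ → trans (cong₂ _+_ pow≡ (trans (keeps G {limitᵛ} refl) limit≡)) (ℕ.+-comm (j * κ ^ i) _))))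
    (λ _ pow≡ → run-≔ (λ _ → pow≡)))))

-- With `e` subtractions to go, `gᵛ` holds `c % k + e * k`. A round takes 14 steps, and there are
-- `c / k` of them, at most `c`.
run-divide : ∀ {s k c} .{{_ : NonZero k}} → vars s kᵛ ≡ k → vars s gᵛ ≡ c →
             Runs divide s (λ s′ → vars s′ gᵛ ≡ c % k × vars s′ qᵛ ≡ c / k) (14 * c + 8)
run-divide {s} {k} {c} k≡ g≡ = weaken
  (run-≔⨟ (subtract (c / k) k≡ (trans g≡ (m≡m%n+[m/n]*n c k)) refl refl))
  (ℕ.≤-trans (ℕ.+-monoʳ-≤ 2 (ℕ.+-monoˡ-≤ 6 (ℕ.*-monoˡ-≤ 14 (m/n≤m c k)))) (ℕ.≤-reflexive (arith c)))
  where
  arith : ∀ c → 2 + (c * 14 + 6) ≡ 14 * c + 8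
  arith = solve-∀
  arith′ : ∀ e → suc (5 + (8 + (e * 14 + 6))) ≡ 14 + e * 14 + 6
  arith′ = solve-∀
  d<k : c % k < k
  d<k = m%n<n c k
  subtract : ∀ e {s q r} → vars s kᵛ ≡ k → vars s gᵛ ≡ c % k + e * k → vars s qᵛ ≡ q → q + e ≡ r →
    Runs (while var gᵛ ⊕ lit 1 ⊖ var kᵛ loop (gᵛ ≔ var gᵛ ⊖ var kᵛ ⨟ qᵛ ≔ var qᵛ ⊕ lit 1)) s
      (λ s′ → vars s′ gᵛ ≡ c % k × vars s′ qᵛ ≡ r) (e * 14 + 6)
  subtract zero {s} {q} k≡ g≡ q≡ q+e≡r = run-while-false
    (trans (cong₂ (λ g k → g + 1 ∸ k) g≡ k≡)
        (ℕ.m≤n⇒m∸n≡0 (ℕ.≤-trans (ℕ.≤-reflexive (trans (ℕ.+-comm _ 1) (cong suc (ℕ.+-identityʳ _)))) d<k)))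
    (trans g≡ (ℕ.+-identityʳ _) , trans q≡ (trans (sym (ℕ.+-identityʳ q)) q+e≡r))
  subtract (suc e) {s} {q} k≡ g≡ q≡ q+e≡r = weaken (run-while-true
    (λ ≡0 → ℕ.<⇒≱ (ℕ.≤-trans k≤g (ℕ.≤-reflexive (ℕ.+-comm 1 _)))
        (ℕ.m∸n≡0⇒m≤n (trans (sym (cong₂ (λ g k → g + 1 ∸ k) g≡ k≡)) ≡0)))
    (run-≔⨟ {e = var gᵛ ⊖ var kᵛ} (run-≔ {Q = λ s′ → vars s′ gᵛ ≡ c % k + e * k × vars s′ qᵛ ≡ suc q}
      (trans (cong₂ _∸_ g≡ k≡) minus , trans (ℕ.+-comm _ 1) (cong suc q≡))))
    (λ G (g≡ , q≡) → subtract e (trans (keeps G {kᵛ} refl) k≡) g≡ q≡ (trans (sym (ℕ.+-suc q e)) q+e≡r)))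
    (ℕ.≤-reflexive (arith′ e))
    where
    k≤g : suc k ≤ suc (c % k + suc e * k)
    k≤g = s≤s (ℕ.≤-trans (ℕ.m≤m+n k (e * k)) (ℕ.m≤n+m _ (c % k)))
    minus : c % k + (k + e * k) ∸ k ≡ c % k + e * k
    minus = trans (cong (_∸ k) (trans (cong (c % k +_) (ℕ.+-comm k _)) (sym (ℕ.+-assoc (c % k) _ k))))
        (ℕ.m+n∸n≡m _ k)

run-forFin : ∀ {x y p s m T} (Inv : ℕ → State → Set) →
  (y ≡ᵇ x) ≡ false → writesVar p x ≡ false → writesVar p y ≡ false → vars s y ≡ m → Inv 0 (setVar x 0 s) →
  (∀ (i : Fin m) {s₁} → Frame (for x below y run p) s s₁ → vars s₁ x ≡ toℕ i → Inv (toℕ i) s₁ →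
    Runs p s₁ (λ s₂ → ∀ v → Inv (suc (toℕ i)) (setVar x v s₂)) T) →
  Runs (for x below y run p) s (Inv m) (m * (T + 8) + 6)
run-forFin {x} {p = p} {T = T} Inv y≢x x∉p y∉p y≡m init step = run-for Inv y≢x x∉p y∉p y≡m init
  (λ {i} {s₁} i<m F → subst (λ i → vars s₁ x ≡ i → Inv i s₁ →
      Runs p s₁ (λ s₂ → ∀ v → Inv (suc i) (setVar x v s₂)) T)
    (toℕ-fromℕ< i<m) (step (fromℕ< i<m) F))

module _ {n} {P Q : Fin n → Set} where

  encodes-⇔ : ∀ a → (∀ {v} → P v → Q v) → (∀ {v} → Q v → P v) → Encodes P a → Encodes Q a
  encodes-⇔ a P⇒Q Q⇒P enc v = (λ q → proj₁ (enc v) (Q⇒P q)) , (λ ¬q → proj₂ (enc v) (λ p → ¬q (P⇒Q p)))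

  encodes-∸ : ∀ a b → (∀ v → Dec (P v)) → (∀ v → Dec (Q v)) → Encodes P a → Encodes Q b →
              Encodes (λ v → P v × ¬ Q v) (λ i → a i ∸ b i)
  encodes-∸ a b P? Q? encP encQ v =
      (λ (p , ¬q) → cong₂ _∸_ (proj₁ (encP v) p) (proj₂ (encQ v) ¬q)) , zero-otherwise
    where
    zero-otherwise : ¬ (P v × ¬ Q v) → a (toℕ v) ∸ b (toℕ v) ≡ 0
    zero-otherwise ¬pq with P? v | Q? v
    ... | no ¬p | _     = trans (cong (_∸ b (toℕ v)) (proj₂ (encP v) ¬p)) (ℕ.0∸n≡0 (b (toℕ v)))
    ... | yes p | yes q = cong₂ _∸_ (proj₁ (encP v) p) (proj₁ (encQ v) q)
    ... | yes p | no ¬q = contradiction (p , ¬q) ¬pq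

  encodes-set : ∀ a {j} (x : Fin n) → j ≡ toℕ x → Q x → (∀ {v} → v ≢ x → P v → Q v) → (∀ {v} → v ≢ x → Q v → P v) →
                Encodes P a → Encodes Q (a [ j ↦ 1 ])
  encodes-set a x refl qx P⇒Q Q⇒P enc v with v ≟ x
  ... | yes refl = (λ _ → [↦]-same a (toℕ v)) , (λ ¬q → contradiction qx ¬q)
  ... | no  v≢x  = (λ q → trans other (proj₁ (enc v) (Q⇒P v≢x q))) ,
      (λ ¬q → trans other (proj₂ (enc v) (λ p → ¬q (P⇒Q v≢x p))))
    where
    other : (a [ toℕ x ↦ 1 ]) (toℕ v) ≡ a (toℕ v)
    other = [↦]-other a (λ eq → v≢x (toℕ-injective eq))

-- Loop overhead is absorbed by raising the coefficient by 8 + 6 per level of nesting; this produces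
-- 94, 123 and 137 below.
iterate-≤ : ∀ A {m X Y} → m ≤ Y → 1 ≤ Y → 1 ≤ X → m * (X * A + 8) + 6 ≤ Y * X * (A + 14)
iterate-≤ A {m} {suc x} {suc y} m≤Y _ _ =
    ℕ.≤-trans (ℕ.+-monoˡ-≤ 6 (ℕ.*-monoˡ-≤ (suc x * A + 8) m≤Y)) (≤-by _ (arith A x y))
  where
  arith : ∀ A x y → suc y * suc x * (A + 14) ≡ suc y * (suc x * A + 8) + 6 + (14 * x + 6 * y + 14 * (x * y))
  arith = solve-∀

-- Correctness and running time of the search program

module Simulation {n} (D : Digraph n) (k : ℕ) .{{_ : NonZero k}} where

  Env : State → Set
  Env s = vars s nᵛ ≡ n × vars s kᵛ ≡ k × arrs s adjᵃ ≡ matrix D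

  env-keep : ∀ {p s s′} → Frame p s s′ → writesVar p nᵛ ≡ false → writesVar p kᵛ ≡ false →
      writesArr p adjᵃ ≡ false → Env s → Env s′
  env-keep F n∉ k∉ adj∉ (n≡ , k≡ , adj≡) =
      trans (keeps F n∉) n≡ , trans (keeps F k∉) k≡ , trans (keepsᵃ F adj∉) adj≡

  -- Soundness as an invariant, kept for right and wrong guesses alike.
  Flag : State → Set
  Flag s = vars s foundᵛ ≡ 0 ⊎ vars s foundᵛ ≡ 1 × HasLeaves D k

  Persists : State → State → Set
  Persists s s′ = vars s foundᵛ ≡ 1 → vars s′ foundᵛ ≡ 1

  module Rooted (r : Fin n) where
    open Growth D r
    open Guided k

    Conf : Subset n → State → Set
    Conf I s = Encodes (Reached I) (arrs s reachedᵃ) × Encodes (_∈ I) (arrs s internalᵃ)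

    conf-keep : ∀ {p s s′ I} → Frame p s s′ → writesArr p reachedᵃ ≡ false → writesArr p internalᵃ ≡ false →
        Conf I s → Conf I s′
    conf-keep F re∉ in∉ (re , int) =
        subst (Encodes _) (sym (keepsᵃ F re∉)) re , subst (Encodes _) (sym (keepsᵃ F in∉)) int

    At : Subset n → State → Set
    At I s = ∃[ u ] (Reached I u × vars s uᵛ ≡ toℕ u)

    run-reset : ∀ {s c} → vars s nᵛ ≡ n → vars s rootᵛ ≡ toℕ r → vars s guessᵛ ≡ c →
      Runs reset s (λ s′ → Conf ⊥ s′ × At ⊥ s′ × vars s′ newᵛ ≡ 0 × vars s′ gᵛ ≡ c) (n * 14 + 15)
    run-reset {s} n≡ r≡ c≡ = weaken
      (run-⨟
        (run-for (λ i s → ∀ {j} → j < i → arrs s reachedᵃ j ≡ 0 × arrs s internalᵃ j ≡ 0) refl refl refl n≡ (λ ())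
          (λ {i} {s₁} _ _ v≡ zeros → run-⟦⟧≔⨟ (run-⟦⟧≔ (λ _ {j} j<1+i → cleared s₁ v≡ zeros (j ℕ.≟ i) j<1+i))))
        (λ {s₁} F zeros → run-⟦⟧≔⨟ (run-≔⨟ (run-≔⨟ (run-≔
          ( ( encodes-set {P = λ _ → Empty.⊥} (arrs s₁ reachedᵃ) r (trans (keeps F {rootᵛ} refl) r≡)
              (inj₁ refl) (λ _ ()) (λ { v≢r (inj₁ v≡r) → v≢r v≡r ; _ (inj₂ (_ , u∈⊥ , _)) → ∉⊥ u∈⊥ })
                (λ v → (λ ()) , λ _ → proj₁ (zeros (toℕ<n v)))
            , λ v → (λ v∈⊥ → contradiction v∈⊥ ∉⊥) , λ _ → proj₂ (zeros (toℕ<n v)))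
          , (r , inj₁ refl , trans (keeps F {rootᵛ} refl) r≡)
          , refl
          , trans (keeps F {guessᵛ} refl) c≡))))))
      (ℕ.≤-reflexive (arith n))
      where
      arith : ∀ n → n * (6 + 8) + 6 + (3 + (2 + (2 + 2))) ≡ n * 14 + 15
      arith = solve-∀
      cleared : ∀ {i j} s₁ → vars s₁ vᵛ ≡ i →
          (∀ {j} → j < i → arrs s₁ reachedᵃ j ≡ 0 × arrs s₁ internalᵃ j ≡ 0) → Dec (j ≡ i) → j < suc i →
        (arrs s₁ reachedᵃ [ vars s₁ vᵛ ↦ 0 ]) j ≡ 0 × (arrs s₁ internalᵃ [ vars s₁ vᵛ ↦ 0 ]) j ≡ 0
      cleared s₁ refl zeros (yes refl) _ = [↦]-same (arrs s₁ reachedᵃ) _ , [↦]-same (arrs s₁ internalᵃ) _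
      cleared s₁ refl zeros (no j≢i) (s≤s j≤i) with re , int ← zeros (ℕ.≤∧≢⇒< j≤i j≢i) =
        trans ([↦]-other (arrs s₁ reachedᵃ) j≢i) re , trans ([↦]-other (arrs s₁ internalᵃ) j≢i) int

    -- If no boundary vertex has rank `d`, all that is known of `uᵛ` is that it holds a reached
    -- vertex. That suffices to keep the set grown.
    run-scan : ∀ {s I d} → vars s nᵛ ≡ n → Conf I s → At I s → vars s gᵛ ≡ d →
      Runs scan s (λ s′ → vars s′ mᵛ ≡ ∣ ∂ I ∣ × At I s′ ×
          (∀ {w} → Boundary I w → rank (∂ I) (toℕ w) ≡ d → vars s′ uᵛ ≡ toℕ w)) (n * 28 + 8)
    run-scan {s} {I} {d} n≡ conf at g≡ = weaken
      (run-≔⨟ {Q = λ s′ → vars s′ mᵛ ≡ ∣ ∂ I ∣ × At I s′ ×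
          (∀ {w} → Boundary I w → rank (∂ I) (toℕ w) ≡ d → vars s′ uᵛ ≡ toℕ w)}
        (run-post (λ (m≡ , at , found) → trans m≡ (rank-all (∂ I)) , at , λ {w} b eq → found w b eq (toℕ<n w))
          (run-forFin Inv refl refl refl n≡ (sym (rank-0 (∂ I)) , at , λ _ _ _ ()) step)))
      (ℕ.≤-reflexive (arith n))
      where
      arith : ∀ n → 2 + (n * (20 + 8) + 6) ≡ n * 28 + 8
      arith = solve-∀
      Inv : ℕ → State → Set
      Inv i s = vars s mᵛ ≡ rank (∂ I) i × At I s ×
          (∀ w → Boundary I w → rank (∂ I) (toℕ w) ≡ d → toℕ w < i → vars s uᵛ ≡ toℕ w)
      step : ∀ (x : Fin n) {s₁} → Frame (for vᵛ below nᵛ run _) (setVar mᵛ 0 s) s₁ → vars s₁ vᵛ ≡ toℕ x →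
          Inv (toℕ x) s₁ →
        Runs _ s₁ (λ s₂ → ∀ v → Inv (suc (toℕ x)) (setVar vᵛ v s₂)) 20
      step x {s₁} F v≡ (m≡ , at , found) = run-if on-boundary off-boundary
        where
        test : Encodes (Boundary I) (λ i → arrs s₁ reachedᵃ i ∸ arrs s₁ internalᵃ i)
        test = let re , int = conf-keep F refl refl conf in encodes-∸ (arrs s₁ reachedᵃ) (arrs s₁ internalᵃ) (reached? I) (_∈? I) re int
        test-x : (Boundary I x → arrs s₁ reachedᵃ (vars s₁ vᵛ) ∸ arrs s₁ internalᵃ (vars s₁ vᵛ) ≡ 1) × _
        test-x = subst (λ i → (Boundary I x → arrs s₁ reachedᵃ i ∸ arrs s₁ internalᵃ i ≡ 1) ×
            (¬ Boundary I x → arrs s₁ reachedᵃ i ∸ arrs s₁ internalᵃ i ≡ 0)) (sym v≡) (test x)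
        g≡₁ : vars s₁ gᵛ ≡ d
        g≡₁ = trans (keeps F {gᵛ} refl) g≡
        off-boundary : _ → Runs skip s₁ _ 1
        off-boundary ≡0 = run-skip (λ _ →
            trans m≡ (sym (rank-∉ (λ x∈ → ¬b (∈⟪⟫⁻ (boundary? I) x∈)))) , at , found′)
          where
          ¬b : ¬ Boundary I x
          ¬b = bit≡0 (proj₁ test-x) ≡0
          found′ : ∀ w → Boundary I w → rank (∂ I) (toℕ w) ≡ d → toℕ w < suc (toℕ x) → vars s₁ uᵛ ≡ toℕ w
          found′ w b eq (s≤s w≤x) = found w b eq
              (ℕ.≤∧≢⇒< w≤x (λ w≡x → ¬b (subst (Boundary I) (toℕ-injective w≡x) b)))
        on-boundary : _ → Runs _ s₁ _ 13
        on-boundary ≢0 = run-⨟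
          {Q′ = λ s₂ → At I s₂ × (∀ w → Boundary I w → rank (∂ I) (toℕ w) ≡ d → toℕ w < suc (toℕ x) →
              vars s₂ uᵛ ≡ toℕ w)}
          (run-if
            (λ m≤d → run-≔ ((x , b , v≡) , λ w bw eq w<1+x → take (≤d m≤d) w bw eq w<1+x))
            (λ d<m → run-skip (at , λ w bw eq w<1+x → keep (d< d<m) w bw eq w<1+x)))
          (λ G (at′ , found′) → run-≔ (λ _ →
              trans (ℕ.+-comm _ 1) (trans (cong suc (trans (keeps G {mᵛ} refl) m≡))
              (sym (rank-∈ (∈⟪⟫⁺ (boundary? I) b′)))) , at′ , found′))
          where
          b′ : Boundary I x
          b′ = bit≢0 (boundary? I x) (proj₂ test-x) ≢0
          b : Reached I x
          b = proj₁ b′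
          ≤d : vars s₁ gᵛ + 1 ∸ vars s₁ mᵛ ≢ 0 → rank (∂ I) (toℕ x) ≤ d
          ≤d ≢0 = ℕ.≮⇒≥ (λ d<m → ≢0 (trans (cong₂ (λ g m → g + 1 ∸ m) g≡₁ m≡)
              (ℕ.m≤n⇒m∸n≡0 (ℕ.≤-trans (ℕ.≤-reflexive (ℕ.+-comm d 1)) d<m))))
          d< : vars s₁ gᵛ + 1 ∸ vars s₁ mᵛ ≡ 0 → d < rank (∂ I) (toℕ x)
          d< ≡0 = ℕ.≤-trans (ℕ.≤-reflexive (ℕ.+-comm 1 d))
              (ℕ.m∸n≡0⇒m≤n (trans (sym (cong₂ (λ g m → g + 1 ∸ m) g≡₁ m≡)) ≡0))
          take : rank (∂ I) (toℕ x) ≤ d → ∀ w → Boundary I w → rank (∂ I) (toℕ w) ≡ d → toℕ w < suc (toℕ x) →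
              vars s₁ vᵛ ≡ toℕ w
          -- A boundary vertex of rank `d` strictly before `x` would push the rank of `x` above `d`.
          take ≤d w bw eq (s≤s w≤x) with toℕ w ℕ.≟ toℕ x
          ... | yes w≡x = trans v≡ (sym w≡x)
          ... | no  w≢x = contradiction
            (ℕ.≤-trans (ℕ.≤-reflexive (trans (cong suc (sym eq)) (sym (rank-∈ (∈⟪⟫⁺ (boundary? I) bw)))))
                (ℕ.≤-trans (rank-mono (∂ I) (ℕ.≤∧≢⇒< w≤x w≢x)) ≤d))
            (ℕ.<-irrefl refl)
          keep : d < rank (∂ I) (toℕ x) → ∀ w → Boundary I w → rank (∂ I) (toℕ w) ≡ d → toℕ w < suc (toℕ x) →
              vars s₁ uᵛ ≡ toℕ w
          keep d< w bw eq (s≤s w≤x) = found w bw eq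
              (ℕ.≤∧≢⇒< w≤x (λ w≡x → ℕ.<⇒≢ d< (trans (sym eq) (cong (rank (∂ I)) w≡x))))

    -- Count u i c w: c of the vertices below i are new out-neighbours of u;
    -- w is the last one, or u itself if there is none.
    data Count (I : Subset n) (u : Fin n) (i : ℕ) : ℕ → Fin n → Set where
      none : (∀ {v} → New I u v → i ≤ toℕ v) → Count I u i 0 u
      one  : ∀ {w} → New I u w → toℕ w < i → (∀ {v} → New I u v → toℕ v < i → v ≡ w) → Count I u i 1 w
      many : ∀ {x y w c} → New I u x → New I u y → x ≢ y → New I u w → Count I u i (2 + c) w

    Counted : Subset n → Fin n → ℕ → State → Set
    Counted I u i s = ∃[ c ] ∃[ w ] (vars s newᵛ ≡ c × vars s uᵛ ≡ toℕ w × Count I u i c w)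

    module _ {I : Subset n} {u : Fin n} where

      private
        ≤∧≢new : ∀ {v x : Fin n} → ¬ New I u x → New I u v → toℕ v ≢ toℕ x
        ≤∧≢new ¬Nx Nv eq = ¬Nx (subst (New I u) (toℕ-injective eq) Nv)

      count-skip : ∀ {x c w} → ¬ New I u x → Count I u (toℕ x) c w → Count I u (suc (toℕ x)) c w
      count-skip ¬Nx (none ≥x) = none (λ Nv → ℕ.≤∧≢⇒< (≥x Nv) (λ eq → ≤∧≢new ¬Nx Nv (sym eq)))
      count-skip ¬Nx (one Nw w<x only) =
          one Nw (ℕ.m<n⇒m<1+n w<x) (λ { Nv (s≤s v≤x) → only Nv (ℕ.≤∧≢⇒< v≤x (≤∧≢new ¬Nx Nv)) })
      count-skip ¬Nx (many Nx Ny x≢y Nw) = many Nx Ny x≢y Nw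

      count-take : ∀ {x c w} → New I u x → Count I u (toℕ x) c w → Count I u (suc (toℕ x)) (suc c) x
      count-take {x} Nx (none ≥x) = one Nx ℕ.≤-refl (λ { Nv (s≤s v≤x) → toℕ-injective (ℕ.≤-antisym v≤x (≥x Nv)) })
      count-take Nx (one Nw w<x _) = many Nw Nx (λ { refl → ℕ.<-irrefl refl w<x }) Nx
      count-take Nx (many Ny Nz y≢z _) = many Ny Nz y≢z Nx

    run-expand : ∀ {s I u} → Env s → Conf I s → vars s uᵛ ≡ toℕ u →
      Runs expand s (λ s′ → Conf (I ∪ ⁅ u ⁆) s′ × Counted I u n s′) (n * 38 + 19)
    run-expand {s} {I} {u} env@(n≡ , k≡ , adj≡) conf u≡ = weaken
      (run-≔⨟ (run-⨟
        (run-for (λ i s → vars s baseᵛ ≡ i * n) refl refl refl u≡ refl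
          (λ {i} _ F _ base≡ → run-≔ (λ _ →
              trans (cong₂ _+_ base≡ (trans (keeps F {nᵛ} refl) n≡)) (ℕ.+-comm (i * n) n))))
        (λ {s₁} F base≡ → run-⟦⟧≔⨟ (run-≔⨟
          (from-base s₁ (env-keep {s = setVar baseᵛ 0 s} F refl refl refl env)
              (conf-keep {s = setVar baseᵛ 0 s} F refl refl conf)
            (trans (keeps F {uᵛ} refl) u≡) (trans base≡ (ℕ.*-comm (toℕ u) n)))))))
      (ℕ.≤-trans (ℕ.+-monoʳ-≤ 2 (ℕ.+-monoˡ-≤ _ (ℕ.+-monoˡ-≤ 6 (ℕ.*-monoˡ-≤ 12 (ℕ.<⇒≤ (toℕ<n u))))))
          (ℕ.≤-reflexive (arith n)))
      where
      arith : ∀ n → 2 + (n * 12 + 6 + (3 + (2 + (n * (18 + 8) + 6)))) ≡ n * 38 + 19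
      arith = solve-∀
      -- The contents of `reachedᵃ` after `i` passes. At `x` itself, before pass `x`, this is still
      -- `Reached I x`, so the test detects exactly the new out-neighbours.
      Partial : ℕ → Fin n → Set
      Partial i v = Reached I v ⊎ Arc D u v × toℕ v < i
      partial? : ∀ i v → Dec (Partial i v)
      partial? i v = reached? I v ⊎-dec (Arc? D u v ×-dec (toℕ v ℕ.<? i))
      complete : ∀ {v} → Partial n v → Reached (I ∪ ⁅ u ⁆) v
      complete (inj₁ R)       = reached-mono (p⊆p∪q ⁅ u ⁆) R
      complete (inj₂ (a , _)) = arc⇒reached-∪ {I} a
      complete⁻ : ∀ {v} → Reached (I ∪ ⁅ u ⁆) v → Partial n v
      complete⁻ {v} R with reached-∪⁻ R
      ... | inj₁ R′ = inj₁ R′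
      ... | inj₂ a  = inj₂ (a , toℕ<n v)
      partial-skip : ∀ {x v} → ¬ New I u x → Partial (suc (toℕ x)) v → Partial (toℕ x) v
      partial-skip ¬Nx (inj₁ R) = inj₁ R
      partial-skip {x} {v} ¬Nx (inj₂ (a , s≤s v≤x)) with v ≟ x
      ... | no  v≢x  = inj₂ (a , ℕ.≤∧≢⇒< v≤x (λ eq → v≢x (toℕ-injective eq)))
      ... | yes refl with reached? I v
      ...   | yes R = inj₁ R
      ...   | no ¬R = contradiction (a , ¬R) ¬Nx
      partial-take : ∀ {x v} → v ≢ x → Partial (suc (toℕ x)) v → Partial (toℕ x) v
      partial-take v≢x (inj₁ R) = inj₁ R
      partial-take v≢x (inj₂ (a , s≤s v≤x)) = inj₂ (a , ℕ.≤∧≢⇒< v≤x (λ eq → v≢x (toℕ-injective eq)))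
      partial-suc : ∀ {i v} → Partial i v → Partial (suc i) v
      partial-suc (inj₁ R)         = inj₁ R
      partial-suc (inj₂ (a , v<i)) = inj₂ (a , ℕ.m<n⇒m<1+n v<i)
      Inv : ℕ → State → Set
      Inv i s = Encodes (Partial i) (arrs s reachedᵃ) × Counted I u i s
      from-base : ∀ s₁ → Env s₁ → Conf I s₁ → vars s₁ uᵛ ≡ toℕ u → vars s₁ baseᵛ ≡ n * toℕ u →
        Runs _ (setVar newᵛ 0 (setArr internalᵃ (vars s₁ uᵛ) 1 s₁))
            (λ s′ → Conf (I ∪ ⁅ u ⁆) s′ × Counted I u n s′) (n * (18 + 8) + 6)
      from-base s₁ (n≡ , k≡ , adj≡) (re , int) u≡ base≡ = run-post (λ {s′} (G , (re′ , counted)) →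
            ( encodes-⇔ (arrs s′ reachedᵃ) complete complete⁻ re′
            , subst (Encodes (_∈ I ∪ ⁅ u ⁆)) (sym (keepsᵃ G {internalᵃ} refl)) internal′)
            , counted)
          (run-framed (run-forFin Inv refl refl refl n≡
            (encodes-⇔ (arrs s₁ reachedᵃ) inj₁
                (λ { (inj₁ R) → R ; (inj₂ (_ , ())) }) re , 0 , u , refl , u≡ , none (λ _ → z≤n))
            step))
        where
        s₂ = setVar newᵛ 0 (setArr internalᵃ (vars s₁ uᵛ) 1 s₁)
        internal′ : Encodes (_∈ I ∪ ⁅ u ⁆) (arrs s₂ internalᵃ)
        internal′ = encodes-set (arrs s₁ internalᵃ) u u≡ (u∈I∪⁅u⁆ {I}) (λ _ v∈I → p⊆p∪q ⁅ u ⁆ v∈I)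
          (λ { {v} v≢u v∈ → case v≢u (x∈p∪q⁻ I ⁅ u ⁆ v∈) }) int
          where
          case : ∀ {v} → v ≢ u → v ∈ I ⊎ v ∈ ⁅ u ⁆ → v ∈ I
          case v≢u (inj₁ v∈I) = v∈I
          case v≢u (inj₂ v∈)  = contradiction (x∈⁅y⁆⇒x≡y u v∈) v≢u
        step : ∀ (x : Fin n) {s₃} → Frame (for vᵛ below nᵛ run _) s₂ s₃ → vars s₃ vᵛ ≡ toℕ x → Inv (toℕ x) s₃ →
          Runs _ s₃ (λ s₄ → ∀ v → Inv (suc (toℕ x)) (setVar vᵛ v s₄)) 18
        step x {s₃} G v≡ (re , c , w , c≡ , w≡ , count) = run-if
          (λ ≢0 → let a , ¬P = bit≢0 (Arc? D u x ×-dec ¬? (partial? (toℕ x) x)) (proj₂ test) ≢0 ; Nx = a , (λ R → ¬P (inj₁ R)) in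
            run-⟦⟧≔⨟ (run-≔⨟ (run-≔ (λ _ →
              encodes-set (arrs s₃ reachedᵃ) x v≡ (inj₂ (a , ℕ.≤-refl)) (λ _ → partial-suc) partial-take re ,
              suc c , x , trans (ℕ.+-comm _ 1) (cong suc c≡) , v≡ , count-take Nx count))))
          (λ ≡0 → let ¬N = λ (a , ¬R) → bit≡0 (proj₁ test) ≡0 (a , λ { (inj₁ R) → ¬R R ; (inj₂ (_ , x<x)) → ℕ.<-irrefl refl x<x }) in
            run-skip (λ _ → encodes-⇔ (arrs s₃ reachedᵃ) partial-suc
                (partial-skip ¬N) re , c , w , c≡ , w≡ , count-skip ¬N count))
          where
          address : vars s₃ baseᵛ + vars s₃ vᵛ ≡ n * toℕ u + toℕ x
          address = cong₂ _+_ (trans (keeps G {baseᵛ} refl) base≡) v≡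
          test : (Arc D u x × ¬ Partial (toℕ x) x →
              arrs s₃ adjᵃ (vars s₃ baseᵛ + vars s₃ vᵛ) ∸ arrs s₃ reachedᵃ (vars s₃ vᵛ) ≡ 1) ×
                 (¬ (Arc D u x × ¬ Partial (toℕ x) x) →
                     arrs s₃ adjᵃ (vars s₃ baseᵛ + vars s₃ vᵛ) ∸ arrs s₃ reachedᵃ (vars s₃ vᵛ) ≡ 0)
          test = subst (λ b → (Arc D u x × ¬ Partial (toℕ x) x → b ≡ 1) ×
              (¬ (Arc D u x × ¬ Partial (toℕ x) x) → b ≡ 0))
            (cong₂ _∸_ (sym (trans (cong (λ f → f (vars s₃ baseᵛ + vars s₃ vᵛ))
                (trans (keepsᵃ G {adjᵃ} refl) adj≡)) (cong (matrix D) address)))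
                (sym (cong (arrs s₃ reachedᵃ) v≡)))
            (encodes-∸ (λ i → matrix D (n * toℕ u + i)) (arrs s₃ reachedᵃ) (Arc? D u) (partial? (toℕ x))
                (matrix-encodes D u) re x)

    run-select : ∀ {s I c} → Env s → Grown I → Conf I s → At I s → Flag s → vars s gᵛ ≡ c →
      Runs select s (λ s′ → At I s′ × Flag s′ × Persists s s′ × (k ≤ ∣ ∂ I ∣ → vars s′ foundᵛ ≡ 1) ×
        vars s′ gᵛ ≡ c / k × (∀ {w} → Boundary I w → rank (∂ I) (toℕ w) ≡ c % k → vars s′ uᵛ ≡ toℕ w))
            (14 * c + 8 + (n * 28 + 8 + 11))
    run-select {s} {I} {c} (n≡ , k≡ , adj≡) G conf (u , Ru , u≡) flag g≡ = run-⨟ (run-divide k≡ g≡)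
      (λ {s₁} F₁ (d≡ , q≡) → run-⨟ (run-scan (trans (keeps F₁ {nᵛ} refl) n≡) (conf-keep F₁ refl refl conf)
          (u , Ru , trans (keeps F₁ {uᵛ} refl) u≡) d≡)
      (λ {s₂} F₂ (m≡ , at , found) →
        let found≡ = trans (keeps F₂ {foundᵛ} refl) (keeps F₁ {foundᵛ} refl)
            k≡₂ = trans (keeps F₂ {kᵛ} refl) (trans (keeps F₁ {kᵛ} refl) k≡)
            test≡ = cong₂ (λ m k → m + 1 ∸ k) m≡ k≡₂
        in run-⨟ {Q′ = λ s₃ → Flag s₃ × Persists s s₃ × (k ≤ ∣ ∂ I ∣ → vars s₃ foundᵛ ≡ 1)}
          (run-if
            (λ ≢0 → run-≔ (inj₂ (refl , grown⇒hasLeaves G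
                (ℕ.≮⇒≥ λ lt → ≢0 (trans test≡
                (ℕ.m≤n⇒m∸n≡0 (ℕ.≤-trans (ℕ.≤-reflexive (ℕ.+-comm _ 1)) lt))))) , (λ _ → refl) , (λ _ → refl)))
            (λ ≡0 → run-skip (subst (λ f → f ≡ 0 ⊎ f ≡ 1 × HasLeaves D k) (sym found≡) flag ,
                (λ f → trans found≡ f) ,
              (λ k≤ → contradiction k≤ (ℕ.<⇒≱
                  (ℕ.≤-trans (ℕ.≤-reflexive (ℕ.+-comm 1 _)) (ℕ.m∸n≡0⇒m≤n (trans (sym test≡) ≡0))))))))
          (λ F₃ (flag′ , persists , enough) → run-≔
            ( (proj₁ at , proj₁ (proj₂ at) , trans (keeps F₃ {uᵛ} refl) (proj₂ (proj₂ at)))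
            , flag′ , persists , enough
            , trans (keeps F₃ {qᵛ} refl) (trans (keeps F₂ {qᵛ} refl) q≡)
            , λ b eq → trans (keeps F₃ {uᵛ} refl) (found b eq)))))

    module _ (s₀ : State) (c : ℕ) where

      -- Only the last component depends on the guess: if `c` is right, either success has been
      -- recorded or the run is on track, as expressed by `P`. The bound by `c` controls the time of
      -- the divisions.
      Search : Set → Subset n → State → Set
      Search P I s = Grown I × Conf I s × At I s × Flag s × Persists s₀ s × vars s gᵛ ≤ c ×
          (Leads ⊥ c → vars s foundᵛ ≡ 1 ⊎ P)

      Ready : Subset n → State → Set
      Ready I s = ∃[ u ] (u ∉ I × vars s uᵛ ≡ toℕ u × Expands I u (vars s gᵛ))

      Mode : Subset n → State → Set
      Mode I s = vars s newᵛ ≢ 1 × Leads I (vars s gᵛ) ⊎ vars s newᵛ ≡ 1 × Ready I s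

      -- The size of `I` is tied to the round only within the promise, since a wrong guess may
      -- expand a vertex of `I` again.
      Inv : ℕ → State → Set
      Inv i s = ∃[ I ] Search (∣ I ∣ ≡ i × Mode I s) I s

      run-round : ∀ {s i} → Env s → Inv i s →
        Runs round s (Inv (suc i)) (8 + (14 * c + 8 + (n * 28 + 8 + 11) + 1) + (n * 38 + 19))
      run-round {s} {i} env (I , G , conf , at , flag , persists , g≤ , promise) =
        run-⨟ {Q′ = λ s₁ → Env s₁ × Search (∣ I ∣ ≡ i × Ready I s₁) I s₁}
          (run-if selecting (λ ≡0 → run-skip (env , G , conf , at , flag , persists , g≤ , skipping ≡0)))
          (λ _ (env₁ , search) → expanding env₁ search)
        where
        selecting : (vars s newᵛ ∸ 1) + (1 ∸ vars s newᵛ) ≢ 0 →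
            Runs select s (λ s₁ → Env s₁ × Search (∣ I ∣ ≡ i × Ready I s₁) I s₁)
            (14 * c + 8 + (n * 28 + 8 + 11))
        selecting ≢0 = weaken
          (run-post (λ {s₁} (F , at₁ , flag₁ , persists₁ , enough , g≡ , ranked) →
            env-keep F refl refl refl env , G , conf-keep F refl refl conf , at₁ , flag₁ ,
                (λ f → persists₁ (persists f)) ,
            ℕ.≤-trans (ℕ.≤-reflexive g≡) (ℕ.≤-trans (m/n≤m (vars s gᵛ) k) g≤) ,
            (λ L → follow {s₁} persists₁ enough g≡ ranked (promise L)))
            (run-framed (run-select env G conf at flag refl)))
          (ℕ.+-monoˡ-≤ _ (ℕ.+-monoˡ-≤ 8 (ℕ.*-monoʳ-≤ 14 g≤)))
          where
          follow : ∀ {s₁} → Persists s s₁ → (k ≤ ∣ ∂ I ∣ → vars s₁ foundᵛ ≡ 1) → vars s₁ gᵛ ≡ vars s gᵛ / k →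
            (∀ {w} → Boundary I w → rank (∂ I) (toℕ w) ≡ vars s gᵛ % k → vars s₁ uᵛ ≡ toℕ w) →
            vars s foundᵛ ≡ 1 ⊎ (∣ I ∣ ≡ i × Mode I s) → vars s₁ foundᵛ ≡ 1 ⊎ (∣ I ∣ ≡ i × Ready I s₁)
          follow persists₁ _ _ _ (inj₁ f) = inj₁ (persists₁ f)
          follow _ _ _ _ (inj₂ (_ , inj₂ (new≡1 , _))) = contradiction (cong (λ m → (m ∸ 1) + (1 ∸ m)) new≡1) ≢0
          follow _ enough _ _ (inj₂ (_ , inj₁ (_ , done k≤))) = inj₁ (enough k≤)
          follow _ _ g≡ ranked (inj₂ (size , inj₁ (_ , pick {u} b eq E))) =
            inj₂ (size , u , proj₂ b , ranked b eq , subst (Expands I u) (sym g≡) E)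
        skipping : (vars s newᵛ ∸ 1) + (1 ∸ vars s newᵛ) ≡ 0 → Leads ⊥ c →
            vars s foundᵛ ≡ 1 ⊎ (∣ I ∣ ≡ i × Ready I s)
        skipping ≡0 L with promise L
        ... | inj₁ f = inj₁ f
        ... | inj₂ (size , inj₂ (_ , ready)) = inj₂ (size , ready)
        ... | inj₂ (_ , inj₁ (new≢1 , _)) =
            contradiction (ℕ.≤-antisym (ℕ.m∸n≡0⇒m≤n (ℕ.m+n≡0⇒m≡0 _ ≡0))
            (ℕ.m∸n≡0⇒m≤n (ℕ.m+n≡0⇒n≡0 (vars s newᵛ ∸ 1) ≡0))) new≢1
        expanding : ∀ {s₁} → Env s₁ → Search (∣ I ∣ ≡ i × Ready I s₁) I s₁ →
            Runs expand s₁ (Inv (suc i)) (n * 38 + 19)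
        expanding {s₁} env₁ (G , conf , (u , Ru , u≡) , flag , persists , g≤ , promise) =
          run-post (λ {s₂} (F , conf₂ , count , w , count≡ , w≡ , counted) →
            let found≡ = keeps F {foundᵛ} refl ; g≡ = keeps F {gᵛ} refl in
            I ∪ ⁅ u ⁆ , extend G Ru , conf₂ , (w , reached-w counted , w≡) ,
            subst (λ f → f ≡ 0 ⊎ f ≡ 1 × HasLeaves D k) (sym found≡) flag ,
            (λ f → trans found≡ (persists f)) ,
            ℕ.≤-trans (ℕ.≤-reflexive g≡) g≤ ,
            λ L → follow {s₂} found≡ g≡ count≡ w≡ counted (promise L))
            (run-framed (run-expand env₁ conf u≡))
          where
          reached-w : ∀ {count w} → Count I u n count w → Reached (I ∪ ⁅ u ⁆) w
          reached-w (none _)          = reached-mono (p⊆p∪q ⁅ u ⁆) Ru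
          reached-w (one (a , _) _ _) = arc⇒reached-∪ {I} a
          reached-w (many _ _ _ (a , _)) = arc⇒reached-∪ {I} a
          -- The count determines the constructor of `Expands`: one new out-neighbour forces `path`,
          -- several force `branch`, none is impossible. So `newᵛ` tells the program which of them
          -- it is following.
          mode : ∀ {s₂ count w} → vars s₂ newᵛ ≡ count → vars s₂ uᵛ ≡ toℕ w → vars s₂ gᵛ ≡ vars s₁ gᵛ →
            Count I u n count w → Expands I u (vars s₁ gᵛ) → Mode (I ∪ ⁅ u ⁆) s₂
          mode _ _ _ (none ≥n) (path {w} N _ _) = contradiction (toℕ<n w) (ℕ.≤⇒≯ (≥n N))
          mode count≡ w≡ g≡ (one {w} Nw _ _) (path N only E) with refl ← only Nw =
            inj₂ (count≡ , w , proj₂ (new⇒boundary G Ru Nw) , w≡ , subst (Expands _ _) (sym g≡) E)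
          mode _ _ _ (many Nx Ny x≢y _) (path _ only _) = contradiction (trans (only Nx) (sym (only Ny))) x≢y
          mode _ _ _ (none ≥n) (branch {w} N _ _ _) = contradiction (toℕ<n w) (ℕ.≤⇒≯ (≥n N))
          mode _ _ _ (one _ _ only) (branch Nx Ny x≢y _) =
              contradiction (trans (only Nx (toℕ<n _)) (sym (only Ny (toℕ<n _)))) x≢y
          mode count≡ _ g≡ (many _ _ _ _) (branch _ _ _ L) =
            inj₁ ((λ new≡1 → contradiction (trans (sym count≡) new≡1) (λ ())) , subst (Leads _) (sym g≡) L)
          follow : ∀ {s₂ count w} → vars s₂ foundᵛ ≡ vars s₁ foundᵛ → vars s₂ gᵛ ≡ vars s₁ gᵛ →
            vars s₂ newᵛ ≡ count → vars s₂ uᵛ ≡ toℕ w → Count I u n count w →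
            vars s₁ foundᵛ ≡ 1 ⊎ (∣ I ∣ ≡ i × Ready I s₁) →
            vars s₂ foundᵛ ≡ 1 ⊎ (∣ I ∪ ⁅ u ⁆ ∣ ≡ suc i × Mode (I ∪ ⁅ u ⁆) s₂)
          follow found≡ _ _ _ _ (inj₁ f) = inj₁ (trans found≡ f)
          follow {s₂} _ g≡ count≡ w≡ counted (inj₂ (size , u′ , u′∉I , u′≡ , E)) with refl ← toℕ-injective
              (trans (sym u′≡) u≡) =
            inj₂ (trans (∣p∪⁅x⁆∣≡1+∣p∣ {p = I} u′∉I) (cong suc size) , mode {s₂} count≡ w≡ g≡ counted E)

    run-trial : ∀ {s c X} → Env s → vars s roundsᵛ ≡ suc n → vars s rootᵛ ≡ toℕ r → vars s guessᵛ ≡ c →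
        Flag s → suc n ≤ X → suc c ≤ X →
      Runs trial s (λ s′ → Flag s′ × Persists s s′ × (Leads ⊥ c → vars s′ foundᵛ ≡ 1)) (suc n * X * 109)
    run-trial {s} {c} {X} env rounds≡ root≡ guess≡ flag n<X c<X = weaken
      (run-⨟ (run-reset (proj₁ env) root≡ guess≡) (λ {s₁} F (conf , at , new≡ , g≡) →
        let found≡ = keeps F {foundᵛ} refl in
        run-post (λ {s′} (I , _ , _ , _ , flag′ , persists , _ , promise) → flag′ , persists , λ L →
            conclude {s = s′} (promise L))
          (run-for (Inv s c) refl refl refl (trans (keeps F {roundsᵛ} refl) rounds≡)
            (⊥ , empty , conf , at , subst (λ f → f ≡ 0 ⊎ f ≡ 1 × HasLeaves D k) (sym found≡) flag ,
                (λ f → trans found≡ f) ,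
             ℕ.≤-reflexive g≡ ,
             λ L → inj₂ (∣⊥∣≡0 n , inj₁ ((λ new≡1 → contradiction (trans (sym new≡) new≡1) (λ ())) , subst
                 (Leads ⊥) (sym g≡) L)))
            (λ _ F′ _ inv → weaken (run-post (λ inv′ _ → inv′)
                (run-round s c (env-keep F′ refl refl refl (env-keep F refl refl refl env)) inv)) round≤))))
      total≤
      where
      conclude : ∀ {I s} → vars s foundᵛ ≡ 1 ⊎ (∣ I ∣ ≡ suc n × Mode s c I s) → vars s foundᵛ ≡ 1
      conclude (inj₁ f) = f
      conclude {I} (inj₂ (size , _)) =
          contradiction (ℕ.≤-trans (ℕ.≤-reflexive (sym size)) (∣p∣≤n I)) (ℕ.<-irrefl refl)
      -- 80 is 14 for the division plus 28 + 38 for the two passes over the vertices.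
      round≤ : 8 + (14 * c + 8 + (n * 28 + 8 + 11) + 1) + (n * 38 + 19) ≤ X * 80
      round≤ = ℕ.≤-trans (≤-by 25 (arith n c))
          (ℕ.≤-trans (ℕ.+-mono-≤ (ℕ.*-monoˡ-≤ 14 c<X) (ℕ.*-monoˡ-≤ 66 n<X))
          (ℕ.≤-reflexive (sym (ℕ.*-distribˡ-+ X 14 66))))
        where
        arith : ∀ n c → suc c * 14 + suc n * 66 ≡ 8 + (14 * c + 8 + (n * 28 + 8 + 11) + 1) + (n * 38 + 19) + 25
        arith = solve-∀
      total≤ : n * 14 + 15 + (suc n * (X * 80 + 8) + 6) ≤ suc n * X * 109
      total≤ = ℕ.≤-trans
        (ℕ.+-mono-≤ (reset≤ X (ℕ.≤-trans (s≤s z≤n) n<X))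
            (iterate-≤ 80 {suc n} ℕ.≤-refl (s≤s z≤n) (ℕ.≤-trans (s≤s z≤n) n<X)))
        (ℕ.≤-reflexive (sym (ℕ.*-distribˡ-+ (suc n * X) 15 94)))
        where
        reset≤ : ∀ X → 1 ≤ X → n * 14 + 15 ≤ suc n * X * 15
        reset≤ (suc x) _ = ≤-by (n + 15 * (x + n * x)) (arith n x)
          where
          arith : ∀ n x → suc n * suc x * 15 ≡ n * 14 + 15 + (n + 15 * (x + n * x))
          arith = solve-∀

  open Rooted using (run-trial)
  open Growth D

  run-guesses : ∀ {s K X} (r : Fin n) → Env s → vars s roundsᵛ ≡ suc n → vars s limitᵛ ≡ K →
      vars s rootᵛ ≡ toℕ r → Flag s →
    1 ≤ K → suc n ≤ X → K ≤ X →
    Runs (for guessᵛ below limitᵛ run trial) s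
      (λ s′ → Flag s′ × Persists s s′ × (∀ {c} → c < K → Guided.Leads r k ⊥ c → vars s′ foundᵛ ≡ 1))
          (K * (suc n * X) * 123)
  run-guesses {s} {K} {X} r env rounds≡ limit≡ root≡ flag 1≤K n<X K≤X = weaken
    (run-for (λ i s′ → Flag s′ × Persists s s′ × (∀ {c} → c < i → Guided.Leads r k ⊥ c → vars s′ foundᵛ ≡ 1))
      refl refl refl limit≡ (flag , (λ f → f) , λ ())
      (λ {i} {s₁} i<K F guess≡ (flag₁ , persists₁ , tried) →
        run-post (λ {s₂} (flag₂ , persists₂ , leads) _ →
            flag₂ , (λ f → persists₂ (persists₁ f)) , λ
            { {c} (s≤s c≤i) L → try {s₁} {s₂} tried persists₂ leads (c ℕ.≟ i) c≤i L })
          (run-trial r (env-keep F refl refl refl env) (trans (keeps F {roundsᵛ} refl) rounds≡)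
              (trans (keeps F {rootᵛ} refl) root≡) guess≡ flag₁ n<X (ℕ.≤-trans i<K K≤X))))
    (iterate-≤ 109 ℕ.≤-refl 1≤K (ℕ.*-mono-≤ (s≤s (z≤n {n})) (ℕ.≤-trans 1≤K K≤X)))
    where
    try : ∀ {s₁ s₂ c i} → (∀ {c} → c < i → Guided.Leads r k ⊥ c → vars s₁ foundᵛ ≡ 1) → Persists s₁ s₂ →
        (Guided.Leads r k ⊥ i → vars s₂ foundᵛ ≡ 1) →
      Dec (c ≡ i) → c ≤ i → Guided.Leads r k ⊥ c → vars s₂ foundᵛ ≡ 1
    try _ _ leads (yes refl) _ L = leads L
    try tried persists _ (no c≢i) c≤i L = persists (tried (ℕ.≤∧≢⇒< c≤i c≢i) L)

  run-roots : ∀ {s K X} → Env s → vars s roundsᵛ ≡ suc n → vars s limitᵛ ≡ K → Flag s → 1 ≤ K → suc n ≤ X → K ≤ X →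
    Runs (for rootᵛ below nᵛ run (for guessᵛ below limitᵛ run trial)) s
      (λ s′ → Flag s′ × (∀ r {c} → c < K → Guided.Leads r k ⊥ c → vars s′ foundᵛ ≡ 1))
          (suc n * (K * (suc n * X)) * 137)
  run-roots {s} {K} {X} env rounds≡ limit≡ flag 1≤K n<X K≤X = weaken
    (run-post (λ (flag , tried) → flag , λ r → tried r (toℕ<n r))
      (run-forFin (λ i s′ → Flag s′ ×
          (∀ r → toℕ r < i → ∀ {c} → c < K → Guided.Leads r k ⊥ c → vars s′ foundᵛ ≡ 1))
        refl refl refl (proj₁ env) (flag , λ _ ())
        (λ x {s₁} F root≡ (flag₁ , tried) →
          run-post (λ {s₂} (flag₂ , persists , leads) _ →
              flag₂ , λ { r (s≤s r≤x) c<K L → try {s₁} {s₂} {x = x} tried persists leads (r ≟ x) r≤x c<K L })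
            (run-guesses x (env-keep F refl refl refl env) (trans (keeps F {roundsᵛ} refl) rounds≡)
                (trans (keeps F {limitᵛ} refl) limit≡) root≡ flag₁ 1≤K n<X K≤X))))
    (iterate-≤ 123 {n} (ℕ.n≤1+n n) (s≤s z≤n) (ℕ.*-mono-≤ 1≤K (ℕ.*-mono-≤ (s≤s (z≤n {n})) (ℕ.≤-trans 1≤K K≤X))))
    where
    try : ∀ {s₁ s₂ r c} {x : Fin n} →
        (∀ r → toℕ r < toℕ x → ∀ {c} → c < K → Guided.Leads r k ⊥ c → vars s₁ foundᵛ ≡ 1) → Persists s₁ s₂ →
      (∀ {c} → c < K → Guided.Leads x k ⊥ c → vars s₂ foundᵛ ≡ 1) →
      Dec (r ≡ x) → toℕ r ≤ toℕ x → c < K → Guided.Leads r k ⊥ c → vars s₂ foundᵛ ≡ 1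
    try _ _ leads (yes refl) _ c<K L = leads c<K L
    try tried persists _ (no r≢x) r≤x c<K L =
        persists (tried _ (ℕ.≤∧≢⇒< r≤x (λ eq → r≢x (toℕ-injective eq))) c<K L)

  Decides : State → Set
  Decides s = output s ≡ 0 × ¬ HasLeaves D k ⊎ output s ≡ 1 × HasLeaves D k

  run-leafOutTree : Runs leafOutTree (input D k) Decides
    (4 + (2 + (k * (2 + (k * 12 + 6 + 2) + 8) + 6) + (suc n * (k ^ k * (suc n * (suc n * k ^ k))) * 137 + 2)))
  run-leafOutTree = run-≔⨟ (run-⨟ (run-power refl) (λ {s₁} F limit≡ →
    run-⨟ (run-roots (env-keep {s = setVar roundsᵛ (n + 1) (input D k)} F refl refl refl
        (refl , refl , refl)) (trans (keeps F {roundsᵛ} refl) (ℕ.+-comm n 1)) limit≡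
        (inj₁ (keeps F {foundᵛ} refl)) 1≤K (ℕ.m≤m*n (suc n) (k ^ k) {{ℕ.m^n≢0 k k}}) (ℕ.m≤n*m (k ^ k) (suc n)))
      (λ {s₂} _ (flag , tried) → run-≔ (decide {s₂} flag tried))))
    where
    1≤K : 1 ≤ k ^ k
    1≤K = ℕ.m^n>0 k k
    decide : ∀ {s} → Flag s → (∀ r {c} → c < k ^ k → Guided.Leads r k ⊥ c → vars s foundᵛ ≡ 1) →
        Decides (setVar nᵛ (vars s foundᵛ) s)
    decide (inj₂ (found , has)) _ = inj₂ (found , has)
    -- The internal vertices of a tree with `k` leaves form a good set, so some guess at its root
    -- leads to success, and that pair was tried.
    decide (inj₁ found) tried = inj₁ (found , λ (T , k≤) →
      let c , c< , L = Guided.good⇒leads (OutTree.root T) k (suc ∣ internals T ∣) ℕ.≤-refl (internals-spanning T , ℕ.≤-trans k≤ (leaves≤∣∂∣ T))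
      in contradiction (trans (sym found) (tried (OutTree.root T) c< L)) (λ ()))

decides⇒dec : ∀ {n} {D : Digraph n} {k p s T} .{{_ : NonZero k}} → Runs p s (Simulation.Decides D k) T →
    Dec (HasLeaves D k)
decides⇒dec (runs _ (inj₁ (_ , ¬has)) _) = no ¬has
decides⇒dec (runs _ (inj₂ (_ , has)) _)  = yes has

-- The verified run is itself the decision procedure that the existence of `ℓ D` calls for.
hasLeaves? : ∀ {n} (D : Digraph n) m .{{_ : NonZero m}} → Dec (HasLeaves D m)
hasLeaves? D m = decides⇒dec (Simulation.run-leafOutTree D m)

answers : ∀ {n} (D : Digraph n) k .{{_ : NonZero k}} {s} → Simulation.Decides D k s → output s Answers (ℓ D ≥ k)
answers D k (inj₁ (≡0 , ¬has)) = inj₂ (≡0 , λ { (_ , ((T , refl) , _) , k≤) → ¬has (T , k≤) })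
answers D k (inj₂ (≡1 , has))  = inj₁ (≡1 , hasLeaves⇒ℓ≥ (λ m → hasLeaves? D m) has)

-- Asymptotics of the time bound

guessBits : ℕ → ℕ
guessBits k = suc ⌊log₂ k ⌋ * k

-- One summand for the number of guesses, the other for splitting a guess into digits.
exponent : ℕ → ℕ
exponent k = guessBits k + guessBits k

-- The three factors stand for roots, rounds and the work in a round; 181 is 14 + 18 + 12 + 137, the
-- coefficients in `time≤`.
polynomial : ℕ → ℕ
polynomial n = suc n * (suc n * suc n) * 181

k≤2^[1+⌊log₂k⌋] : ∀ k → k ≤ 2 ^ suc ⌊log₂ k ⌋
k≤2^[1+⌊log₂k⌋] k = ℕ.≮⇒≥ λ lt → ℕ.<-irrefl refl
  (ℕ.≤-trans (ℕ.≤-reflexive (sym (⌊log₂[2^n]⌋≡n (suc ⌊log₂ k ⌋)))) (⌊log₂⌋-mono-≤ (ℕ.<⇒≤ lt)))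

exponent∈O : exponent ∈O (λ k → k * ⌊log₂ k ⌋)
-- At 1 the logarithm vanishes but the exponent does not. From 2 on the logarithm is at least 1, so
-- adding 1 at most doubles it.
exponent∈O = 4 , 2 , λ k 2≤k → bound k ⌊log₂ k ⌋
    (ℕ.≤-trans (ℕ.≤-reflexive (sym (⌊log₂[2^n]⌋≡n 1))) (⌊log₂⌋-mono-≤ 2≤k))
  where
  arith : ∀ k l → 4 * (k * suc l) ≡ suc (suc l) * k + suc (suc l) * k + 2 * (l * k)
  arith = solve-∀
  bound : ∀ k l → 1 ≤ l → suc l * k + suc l * k ≤ 4 * (k * l)
  bound k (suc l) _ = ≤-by _ (arith k l)

polynomial∈n^O[1] : polynomial ∈n^O[1]
polynomial∈n^O[1] = 3 , 8 * 181 , 1 , λ n 1≤n → ℕ.≤-trans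
  (ℕ.*-monoˡ-≤ 181 (ℕ.*-mono-≤ (2n 1≤n) (ℕ.*-mono-≤ (2n 1≤n) (2n 1≤n))))
  (ℕ.≤-reflexive (arith n))
  where
  2n : ∀ {n} → 1 ≤ n → suc n ≤ n + n
  2n {n} 1≤n = ℕ.+-monoˡ-≤ n 1≤n
  arith : ∀ n → (n + n) * ((n + n) * (n + n)) * 181 ≡ 8 * 181 * (n * (n * (n * 1)))
  arith = solve-∀

time≤ : ∀ n k .{{_ : NonZero k}} →
  4 + (2 + (k * (2 + (k * 12 + 6 + 2) + 8) + 6) + (suc n * (k ^ k * (suc n * (suc n * k ^ k))) * 137 + 2)) ≤
      2 ^ exponent k * polynomial n
time≤ n k = begin
  4 + (2 + (k * (2 + (k * 12 + 6 + 2) + 8) + 6) + (suc n * (K * (suc n * (suc n * K))) * 137 + 2))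
    ≡⟨ expanded k (suc n) K ⟩
  -- Padding with factors 1 gives all summands the shape to which `scale` applies.
  1 * 1 * 1 * 14 + k * 1 * 1 * 18 + k * k * 1 * 12 + K * K * W * 137
    ≤⟨ ℕ.+-mono-≤ (ℕ.+-mono-≤ (ℕ.+-mono-≤ (scale 14 1≤E 1≤E 1≤W) (scale 18 k≤E 1≤E 1≤W))
        (scale 12 k≤E k≤E 1≤W)) (scale 137 K≤E K≤E ℕ.≤-refl) ⟩
  E * E * W * 14 + E * E * W * 18 + E * E * W * 12 + E * E * W * 137
    ≡⟨ collected E W ⟩
  E * E * (W * 181)
    ≡⟨ cong (_* (W * 181)) (sym (ℕ.^-distribˡ-+-* 2 (guessBits k) (guessBits k))) ⟩
  2 ^ exponent k * polynomial n ∎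
  where
  open ℕ.≤-Reasoning
  E = 2 ^ guessBits k
  K = k ^ k
  W = suc n * (suc n * suc n)
  1≤E : 1 ≤ E
  1≤E = ℕ.m^n>0 2 (guessBits k)
  1≤W : 1 ≤ W
  1≤W = s≤s z≤n
  k≤E : k ≤ E
  k≤E = ℕ.≤-trans (k≤2^[1+⌊log₂k⌋] k) (ℕ.^-monoʳ-≤ 2 (ℕ.m≤m*n (suc ⌊log₂ k ⌋) k))
  K≤E : K ≤ E
  K≤E = ℕ.≤-trans (ℕ.^-monoˡ-≤ k (k≤2^[1+⌊log₂k⌋] k)) (ℕ.≤-reflexive (ℕ.^-*-assoc 2 (suc ⌊log₂ k ⌋) k))
  scale : ∀ c {x y z} → x ≤ E → y ≤ E → z ≤ W → x * y * z * c ≤ E * E * W * c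
  scale c x≤ y≤ z≤ = ℕ.*-monoˡ-≤ c (ℕ.*-mono-≤ (ℕ.*-mono-≤ x≤ y≤) z≤)
  expanded : ∀ k N K → 4 + (2 + (k * (2 + (k * 12 + 6 + 2) + 8) + 6) + (N * (K * (N * (N * K))) * 137 + 2)) ≡
    1 * 1 * 1 * 14 + k * 1 * 1 * 18 + k * k * 1 * 12 + K * K * (N * (N * N)) * 137
  expanded = solve-∀
  collected : ∀ E W → E * E * W * 14 + E * E * W * 18 + E * E * W * 12 + E * E * W * 137 ≡ E * E * (W * 181)
  collected = solve-∀

conclude : ∀ {n} {D : Digraph n} {k p s T U} .{{_ : NonZero k}} → Runs p s (Simulation.Decides D k) T → T ≤ U →
  ∃[ s′ ] ∃[ t ] (p , s ⇓ s′ after t) × output s′ Answers (ℓ D ≥ k) × t ≤ U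
conclude {D = D} {k} (runs {s′} d post t≤) T≤ = s′ , _ , d , answers D k {s′} post , ℕ.≤-trans t≤ T≤

theorem1 : ∃[ P ] ∃[ g ] ∃[ h ]
    g ∈O (λ k → k * ⌊log₂ k ⌋) ×
    h ∈n^O[1] ×
    (∀ (n : ℕ) (D : Digraph n) (k : ℕ) .{{_ : NonZero k}} →
    ∃[ s ] ∃[ t ]
    (P , input D k ⇓ s after t) ×
    output s Answers (ℓ D ≥ k) ×
    t ≤ 2 ^ g k * h n)
theorem1 = leafOutTree , exponent , polynomial , exponent∈O , polynomial∈n^O[1] ,
  λ n D k → conclude (Simulation.run-leafOutTree D k) (time≤ n k)
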